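{- For every natural number $n\geq 1$, $\mathcal{TC}(\mathrm{RL}_n^V)=\mathrm{CS}$.
   Context: $\mathrm{CS}$ denotes the family of context-sensitive languages. A right-linear grammar is $G=(N,T,P,S)$ with rules of the form $A\to wB$ or $A\to w$, $A,B\in N$, $w\in T^*$. $\mathrm{RL}_n^V$ is the family of regular languages generated by some right-linear grammar with at most $n$ non-terminal symbols. A tree-controlled grammar is a quintuple $G=(N,T,P,S,R)$ where $(N,T,P,S)$ is a context-free grammar whose rules are all non-erasing (the only exception being that $S\to\lambda$ is allowed if $S$ does not occur on the right-hand side of any rule), and $R$ is a regular language over $N\cup T$. For a derivation tree, the word of level $j$ is the word formed by all nodes of depth $j$ read from left to right. $L(G)$ consists of all $z\in T^*$ having a derivation tree $t$ whose leaves read left to right give $z$ and such that the words of all levels of $t$, except the last one, belong to $R$. For a family $\mathcal{F}$ of regular languages, $\mathcal{TC}(\mathcal{F})$ is the family of languages $L(G)$ of tree-controlled grammars with $R\in\mathcal{F}$. -}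

module Defs where

open import Data.Nat using (ℕ; zero; suc; _≤_; _⊔_)
open import Data.Fin using (Fin)
open import Data.Sum using (_⊎_; inj₁; inj₂)
open import Data.Product using (Σ; _×_; _,_; proj₁; proj₂)
open import Data.Maybe using (Maybe; just; nothing)
open import Data.List using (List; []; _∷_; _++_; [_]; map)
open import Data.List.Membership.Propositional using (_∈_; _∉_)
open import Data.List.Relation.Unary.All using (All)
open import Relation.Binary.PropositionalEquality using (_≡_; _≢_)
open import Relation.Binary.Construct.Closure.ReflexiveTransitive using (Star)
open import Function.Bundles using (_⇔_)

Lang : ℕ → Set₁
Lang k = List (Fin k) → Set

-- Sentential-form symbols: nonterminals Fin m, terminals Fin k
Sym : ℕ → ℕ → Set
Sym m k = Fin m ⊎ Fin k

-- Right-linear grammars over an arbitrary (terminal) alphabet Σ.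
-- A rule (A , w , just B) is A → wB, a rule (A , w , nothing) is A → w.

record RLG (Σ' : Set) : Set where
  field
    nts   : ℕ
    start : Fin nts
    rules : List (Fin nts × List Σ' × Maybe (Fin nts))

module _ {Σ' : Set} (H : RLG Σ') where
  open RLG H
  data RLDerives : Fin nts → List Σ' → Set where
    stop : ∀ {A w} → (A , w , nothing) ∈ rules → RLDerives A w
    step : ∀ {A B w z} → (A , w , just B) ∈ rules → RLDerives B z →
           RLDerives A (w ++ z)

L-RLG : {Σ' : Set} → RLG Σ' → List Σ' → Set
L-RLG H = RLDerives H (RLG.start H)

-- Derivation trees over nonterminals Fin m and terminals Fin k.
-- An inner node labelled A with children ts uses the rule A → (root labels of ts);
-- a node with no children represents the erasing rule A → λ (its only
-- child being a λ-leaf, so it has height 1 and an empty level 1).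

data Tree (m k : ℕ) : Set where
  leaf : Fin k → Tree m k
  node : Fin m → List (Tree m k) → Tree m k

module _ {m k : ℕ} where
  root : Tree m k → Sym m k
  root (leaf a)    = inj₂ a
  root (node A ts) = inj₁ A

  mutual
    yield : Tree m k → List (Fin k)
    yield (leaf a)    = [ a ]
    yield (node A ts) = yields ts

    yields : List (Tree m k) → List (Fin k)
    yields []       = []
    yields (t ∷ ts) = yield t ++ yields ts

  mutual
    level : ℕ → Tree m k → List (Sym m k)
    level zero    t           = [ root t ]
    level (suc j) (leaf a)    = []
    level (suc j) (node A ts) = levels j ts

    levels : ℕ → List (Tree m k) → List (Sym m k)
    levels j []       = []
    levels j (t ∷ ts) = level j t ++ levels j ts

  mutual
    height : Tree m k → ℕ
    height (leaf a)    = 0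
    height (node A ts) = suc (heights ts)

    heights : List (Tree m k) → ℕ
    heights []       = 0
    heights (t ∷ ts) = height t ⊔ heights ts

  data ValidTree (P : List (Fin m × List (Sym m k))) : Tree m k → Set where
    leaf : ∀ a → ValidTree P (leaf a)
    node : ∀ {A ts} → (A , map root ts) ∈ P → All (ValidTree P) ts →
           ValidTree P (node A ts)

record TCG (k : ℕ) : Set where
  field
    nts   : ℕ
    start : Fin nts
    rules : List (Fin nts × List (Sym nts k))
    nonErasing : All (λ r → proj₂ r ≡ [] →
                   (proj₁ r ≡ start) × All (λ r' → inj₁ start ∉ proj₂ r') rules) rules
    control : RLG (Sym nts k)

L-TCG : ∀ {k} → TCG k → Lang k
L-TCG {k} G z = Σ (Tree nts k) λ t →
    root t ≡ inj₁ start × ValidTree rules t × yield t ≡ z ×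
    (∀ j → suc j ≤ height t → L-RLG control (level j t))
  where open TCG G

InTC-RL : ℕ → ∀ {k} → Lang k → Set
InTC-RL n {k} L = Σ (TCG k) λ G →
  RLG.nts (TCG.control G) ≤ n × (∀ z → L z ⇔ L-TCG G z)

-- Context-sensitive grammars: rules αAβ → αγβ with γ ≠ λ, plus S → λ
-- allowed when S does not occur on any right-hand side.
-- A rule is stored as (α , A , β , γ).

CSRule : ℕ → ℕ → Set
CSRule m k = List (Sym m k) × Fin m × List (Sym m k) × List (Sym m k)

lhs : ∀ {m k} → CSRule m k → List (Sym m k)
lhs (α , A , β , γ) = α ++ inj₁ A ∷ β

rhs : ∀ {m k} → CSRule m k → List (Sym m k)
rhs (α , A , β , γ) = α ++ γ ++ β

record CSG (k : ℕ) : Set where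
  field
    nts   : ℕ
    start : Fin nts
    rules : List (CSRule nts k)
    wellFormed : All (λ r → proj₂ (proj₂ (proj₂ r)) ≡ [] →
                   (proj₁ r ≡ [] × proj₁ (proj₂ r) ≡ start ×
                    proj₁ (proj₂ (proj₂ r)) ≡ []) ×
                   All (λ r' → inj₁ start ∉ rhs r') rules) rules

module _ {k : ℕ} (G : CSG k) where
  open CSG G
  data CSStep : List (Sym nts k) → List (Sym nts k) → Set where
    apply : ∀ {r} u v → r ∈ rules → CSStep (u ++ lhs r ++ v) (u ++ rhs r ++ v)

L-CSG : ∀ {k} → CSG k → Lang k
L-CSG G z = Star (CSStep G) [ inj₁ (CSG.start G) ] (map inj₂ z)

InCS : ∀ {k} → Lang k → Set
InCS {k} L = Σ (CSG k) λ G → ∀ z → L z ⇔ L-CSG G z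

{-# OPTIONS --safe #-}
module Submission where

-- Both inclusions argue about the sequence of level words of a derivation tree, in which
-- terminals that have already appeared are carried along as finished items.
--
-- CS ⊆ TC: a context-sensitive rule αAβ → αγβ is applied in two levels, A → ⟨r⟩ and ⟨r⟩ → γ,
-- while all other symbols are copied.  The control language W* with W finite, which needs a
-- single nonterminal, lets ⟨r⟩ occur only inside the word α⟨r⟩β.
--
-- TC ⊆ CS: a head sweeping over the sentential form checks a level word with a finite automaton
-- and then expands it to the next one.  Its rules have the shapes A → Xγ and AB → CXγ, and such
-- rules can be split into context-sensitive ones.

open import Defs
open import Data.Bool using (Bool; true; false; _∧_)
open import Data.Bool.Properties using (∧-assoc; ∧-identityʳ)
open import Data.Empty using (⊥; ⊥-elim)
open import Data.Fin using (Fin; zero; suc; splitAt; join; remQuot; combine)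
import Data.Fin as Fin
open import Data.Fin.Properties using (any?; splitAt-join; remQuot-combine)
open import Data.List using (List; []; _∷_; _++_; [_]; _∷ʳ_; map; allFin; concatMap; filter; initLast; _∷ʳ′_; length; lookup; null)
import Data.List as List
import Data.List.Membership.DecPropositional as DecMembership
open import Data.List.Membership.Propositional using (_∈_; _∉_; find; lose)
open import Data.List.Membership.Propositional.Properties using (∈-++⁺ˡ; ∈-++⁺ʳ; ∈-++⁻; ∈-allFin; ∈-concatMap⁺; ∈-concatMap⁻; ∈-filter⁺; ∈-filter⁻; ∈-lookup; ∈-map⁺; ∈-map⁻)
open import Data.List.Properties using (++-assoc; ++-conicalˡ; ++-conicalʳ; ++-identityʳ; ∷-injective; ∷ʳ-injective; map-++)
import Data.List.Properties as List
open import Data.List.Relation.Binary.Pointwise using (Pointwise; []; _∷_)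
open import Data.List.Relation.Unary.All using (All; []; _∷_)
import Data.List.Relation.Unary.All as All
import Data.List.Relation.Unary.All.Properties as All
open import Data.List.Relation.Unary.Any using (here; there; index)
open import Data.List.Relation.Unary.Any.Properties using (lookup-index)
open import Data.List.Reverse using (Reverse; []; _∶_∶ʳ_; reverseView)
open import Data.Maybe using (Maybe; just; nothing)
import Data.Maybe.Properties as Maybe
open import Data.Nat using (ℕ; zero; suc; pred; _+_; _*_; _≤_; _<_; _⊔_; z≤n; s≤s)
open import Data.Nat.Properties using (m≤m⊔n; mono-≤-distrib-⊔; pred-mono-≤; ⊔-assoc; ⊔-identityʳ)
open import Data.Product using (∃-syntax; _×_; _,_; proj₁; proj₂)
import Data.Product.Properties as Product
open import Data.Sum using (_⊎_; inj₁; inj₂; map₁)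
import Data.Sum as Sum
open import Data.Sum.Properties using (inj₁-injective)
import Data.Sum.Properties as Sum
open import Data.Unit using (⊤; tt)
open import Function.Bundles using (_⇔_; mk⇔; Equivalence)
open import Function.Properties.Equivalence using () renaming (trans to ⇔-trans)
open import Relation.Binary using (Decidable; DecidableEquality)
open import Relation.Binary.Construct.Closure.ReflexiveTransitive using (Star; ε; _◅_; _◅◅_; gmap)
open import Relation.Binary.PropositionalEquality using (_≡_; _≢_; refl; sym; trans; cong; cong₂; subst; subst₂; module ≡-Reasoning)
open import Relation.Nullary using (Dec; yes; no; ¬?; contradiction)
open import Relation.Nullary.Decidable using (map′; _×-dec_; _⊎-dec_)
open import Relation.Unary using () renaming (Decidable to Decidable₁)

-- Levels of derivation trees

-- The control language sees one level word at a time and never compares two levels. A rule choice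
-- must therefore be visible on a level where its context still stands, and this is why a rule takes
-- two levels, the first of which only records the choice. In the other direction the obstacle is
-- that context-sensitive rules never shorten the word. The head, its automaton state and the end
-- markers would have to be removed at the end if they had symbols of their own, so they are all
-- stored inside the symbols that carry the items. In both directions a sentential form may show a
-- simulation half done. Soundness therefore rests on functions (`decode`, `readBack`) that read
-- every intermediate word as a genuine one, so that each step becomes either an equality or an
-- actual rule application. The empty word is treated apart throughout: if S → λ is present, then S
-- occurs on no right-hand side, and that rule can act only in the first step.

data Item (m k : ℕ) : Set where
  live : Sym m k → Item m k
  done : Fin k → Item m k

live-injective : ∀ {m k} {x y : Sym m k} → Item.live x ≡ live y → x ≡ y
live-injective refl = refl

data Terminal {m k} : Item m k → Fin k → Set where
  done : ∀ {a} → Terminal (done a) a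
  live : ∀ {a} → Terminal (live (inj₂ a)) a

Prods : ℕ → ℕ → Set
Prods m k = List (Fin m × List (Sym m k))

data Expand {m k} (P : Prods m k) : Item m k → List (Item m k) → Set where
  done : ∀ {a} → Expand P (done a) [ done a ]
  term : ∀ {a} → Expand P (live (inj₂ a)) [ done a ]
  prod : ∀ {A γ} → (A , γ) ∈ P → Expand P (live (inj₁ A)) (map live γ)

data Par {m k} (P : Prods m k) : List (Item m k) → List (Item m k) → Set where
  []  : Par P [] []
  _∷_ : ∀ {x γ c c′} → Expand P x γ → Par P c c′ → Par P (x ∷ c) (γ ++ c′)

module _ {m k : ℕ} where

  lives : List (Item m k) → List (Sym m k)
  lives []           = []
  lives (live x ∷ c) = x ∷ lives c
  lives (done a ∷ c) = lives c

  lives-++ : ∀ c d → lives (c ++ d) ≡ lives c ++ lives d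
  lives-++ []           d = refl
  lives-++ (live x ∷ c) d = cong (x ∷_) (lives-++ c d)
  lives-++ (done a ∷ c) d = lives-++ c d

-- A terminal that appears on some level stays in the configuration as a 'done' item,
-- invisible to the control language from the next level on.
data Run {m k} (P : Prods m k) (R : List (Sym m k) → Set) :
         List (Item m k) → List (Fin k) → Set where
  stop : ∀ {c z} → Pointwise Terminal c z → Run P R c z
  step : ∀ {c d z} → R (lives c) → Par P c d → Run P R d z → Run P R c z

map-++⁻ : ∀ {A B : Set} (f : A → B) xs {ys zs} → map f xs ≡ ys ++ zs →
          ∃[ us ] ∃[ vs ] xs ≡ us ++ vs × map f us ≡ ys × map f vs ≡ zs
map-++⁻ f xs       {[]}     eq   = [] , xs , refl , refl , eq
map-++⁻ f (x ∷ xs) {y ∷ ys} eq with ∷-injective eq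
... | refl , eq′ with map-++⁻ f xs {ys} eq′
...   | us , vs , refl , refl , refl = x ∷ us , vs , refl , refl , refl

-- Forests left after cutting a derivation tree at a level

module _ {m k : ℕ} where

  -- Cutting a tree at some depth leaves the subtrees rooted there and, between them, the terminals
  -- whose leaves lie higher up. The latter belong to no further level but keep their place in the
  -- yield.
  Forest : Set
  Forest = List (Tree m k ⊎ Fin k)

  item : Tree m k ⊎ Fin k → Item m k
  item (inj₁ t) = live (root t)
  item (inj₂ a) = done a

  config : Forest → List (Item m k)
  config = map item

  next : Forest → Forest
  next []                    = []
  next (inj₁ (leaf a) ∷ F)    = inj₂ a ∷ next F
  next (inj₁ (node A ts) ∷ F) = map inj₁ ts ++ next F
  next (inj₂ a ∷ F)           = inj₂ a ∷ next F

  yieldF : Forest → List (Fin k)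
  yieldF []           = []
  yieldF (inj₁ t ∷ F) = yield t ++ yieldF F
  yieldF (inj₂ a ∷ F) = a ∷ yieldF F

  levelF : ℕ → Forest → List (Sym m k)
  levelF j []           = []
  levelF j (inj₁ t ∷ F) = level j t ++ levelF j F
  levelF j (inj₂ a ∷ F) = levelF j F

  heightF : Forest → ℕ
  heightF []           = 0
  heightF (inj₁ t ∷ F) = height t ⊔ heightF F
  heightF (inj₂ a ∷ F) = heightF F

  data Valid (P : Prods m k) : Tree m k ⊎ Fin k → Set where
    tree : ∀ {t} → ValidTree P t → Valid P (inj₁ t)
    done : ∀ {a} → Valid P (inj₂ a)

  yieldF-map : ∀ ts F → yieldF (map inj₁ ts ++ F) ≡ yields ts ++ yieldF F
  yieldF-map []       F = refl
  yieldF-map (t ∷ ts) F = trans (cong (yield t ++_) (yieldF-map ts F))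
                                (sym (++-assoc (yield t) _ _))

  levelF-map : ∀ j ts F → levelF j (map inj₁ ts ++ F) ≡ levels j ts ++ levelF j F
  levelF-map j []       F = refl
  levelF-map j (t ∷ ts) F = trans (cong (level j t ++_) (levelF-map j ts F))
                                  (sym (++-assoc (level j t) _ _))

  heightF-map : ∀ ts F → heightF (map inj₁ ts ++ F) ≡ heights ts ⊔ heightF F
  heightF-map []       F = refl
  heightF-map (t ∷ ts) F = trans (cong (height t ⊔_) (heightF-map ts F))
                                 (sym (⊔-assoc (height t) _ _))

  yieldF-next : ∀ F → yieldF (next F) ≡ yieldF F
  yieldF-next []                    = refl
  yieldF-next (inj₁ (leaf a) ∷ F)    = cong (a ∷_) (yieldF-next F)
  yieldF-next (inj₁ (node A ts) ∷ F) =
    trans (yieldF-map ts (next F)) (cong (yields ts ++_) (yieldF-next F))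
  yieldF-next (inj₂ a ∷ F)           = cong (a ∷_) (yieldF-next F)

  levelF-next : ∀ j F → levelF j (next F) ≡ levelF (suc j) F
  levelF-next j []                    = refl
  levelF-next j (inj₁ (leaf a) ∷ F)    = levelF-next j F
  levelF-next j (inj₁ (node A ts) ∷ F) =
    trans (levelF-map j ts (next F)) (cong (levels j ts ++_) (levelF-next j F))
  levelF-next j (inj₂ a ∷ F)           = levelF-next j F

  heightF-next : ∀ F → heightF (next F) ≡ pred (heightF F)
  heightF-next []                    = refl
  heightF-next (inj₁ (leaf a) ∷ F)    = heightF-next F
  heightF-next (inj₁ (node A ts) ∷ F) = begin
    heightF (map inj₁ ts ++ next F)   ≡⟨ heightF-map ts (next F) ⟩
    heights ts ⊔ heightF (next F)     ≡⟨ cong (heights ts ⊔_) (heightF-next F) ⟩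
    pred (suc (heights ts)) ⊔ pred (heightF F)
      ≡⟨ sym (mono-≤-distrib-⊔ pred-mono-≤ (suc (heights ts)) (heightF F)) ⟩
    pred (suc (heights ts) ⊔ heightF F) ∎
    where open ≡-Reasoning
  heightF-next (inj₂ a ∷ F)           = heightF-next F

  levelF-zero : ∀ F → levelF 0 F ≡ lives (config F)
  levelF-zero []           = refl
  levelF-zero (inj₁ t ∷ F) = cong (root t ∷_) (levelF-zero F)
  levelF-zero (inj₂ a ∷ F) = levelF-zero F

  config-trees : ∀ ts → config (map inj₁ ts) ≡ map live (map root ts)
  config-trees []       = refl
  config-trees (t ∷ ts) = cong (_ ∷_) (config-trees ts)

  module _ {P : Prods m k} where

    valid-trees : ∀ {ts F} → All (ValidTree P) ts → All (Valid P) F →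
                  All (Valid P) (map inj₁ ts ++ F)
    valid-trees []       vF = vF
    valid-trees (v ∷ vs) vF = tree v ∷ valid-trees vs vF

    valid-trees⁻ : ∀ ts {F} → All (Valid P) (map inj₁ ts ++ F) →
                   All (ValidTree P) ts × All (Valid P) F
    valid-trees⁻ []       vF            = [] , vF
    valid-trees⁻ (t ∷ ts) (tree v ∷ vF) with valid-trees⁻ ts vF
    ... | vs , vF′ = v ∷ vs , vF′

    valid-next : ∀ {F} → All (Valid P) F → All (Valid P) (next F)
    valid-next []                        = []
    valid-next (tree (leaf a) ∷ vF)      = done ∷ valid-next vF
    valid-next (tree (node p vts) ∷ vF)  = valid-trees vts (valid-next vF)
    valid-next (done ∷ vF)               = done ∷ valid-next vF

    par-next : ∀ {F} → All (Valid P) F → Par P (config F) (config (next F))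
    par-next []                       = []
    par-next (tree (leaf a) ∷ vF)     = term ∷ par-next vF
    par-next (tree (node {ts = ts} p vts) ∷ vF) =
      subst (Par P _)
        (trans (cong (_++ _) (sym (config-trees ts))) (sym (map-++ item (map inj₁ ts) _)))
        (prod p ∷ par-next vF)
    par-next (done ∷ vF)              = done ∷ par-next vF

  height-zero : ∀ F → heightF F ≡ 0 → Pointwise Terminal (config F) (yieldF F)
  height-zero []                    eq = []
  height-zero (inj₁ (leaf a) ∷ F)    eq = live ∷ height-zero F eq
  height-zero (inj₁ (node A ts) ∷ F) eq
    with () ← subst (height (node A ts) ≤_) eq (m≤m⊔n _ (heightF F))
  height-zero (inj₂ a ∷ F)           eq = done ∷ height-zero F eq

  -- The height is a separate argument because `next F` is not structurally smaller than `F`. At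
  -- height 0 only terminals are left, and the run stops without a check, just as the last level of
  -- a tree is exempt from control.
  forest⇒run : ∀ {P R} h F → heightF F ≡ h → All (Valid P) F →
               (∀ j → j < heightF F → R (levelF j F)) → Run P R (config F) (yieldF F)
  forest⇒run zero    F eq vF ctl = stop (height-zero F eq)
  forest⇒run {R = R} (suc h) F eq vF ctl =
    step (subst R (levelF-zero F) (ctl 0 (subst (0 <_) (sym eq) (s≤s z≤n))))
         (par-next vF)
         (subst (Run _ _ _) (yieldF-next F)
           (forest⇒run h (next F) height≡ (valid-next vF)
             λ j j< → subst R (sym (levelF-next j F))
               (ctl (suc j) (subst (suc j <_) (sym eq) (s≤s (subst (j <_) height≡ j<))))))
    where
    height≡ : heightF (next F) ≡ h
    height≡ = trans (heightF-next F) (cong pred eq)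

  terminal-forest : ∀ {P c z} → Pointwise Terminal c z →
    ∃[ F ] config F ≡ c × yieldF F ≡ z × All (Valid P) F × heightF F ≡ 0
  terminal-forest [] = [] , refl , refl , [] , refl
  terminal-forest (done {a} ∷ ts) with terminal-forest ts
  ... | F , refl , refl , vF , h = inj₂ a ∷ F , refl , refl , done ∷ vF , h
  terminal-forest (live {a} ∷ ts) with terminal-forest ts
  ... | F , refl , refl , vF , h =
    inj₁ (leaf a) ∷ F , refl , refl , tree (leaf a) ∷ vF , h

  trees-of-lives : ∀ F γ → config F ≡ map live γ → ∃[ ts ] F ≡ map inj₁ ts × map root ts ≡ γ
  trees-of-lives []           []      eq = [] , refl , refl
  trees-of-lives (inj₁ t ∷ F) (x ∷ γ) eq with ∷-injective eq
  ... | refl , eq′ with trees-of-lives F γ eq′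
  ...   | ts , refl , refl = t ∷ ts , refl , refl
  trees-of-lives (inj₂ a ∷ F) (x ∷ γ) ()

  -- Trees are rebuilt from the bottom: the forest of the lower level falls into consecutive blocks,
  -- one for each item of the upper level, and the block of a nonterminal becomes the list of
  -- children of a new node.
  grow : ∀ {P c d} → Par P c d → ∀ F′ → config F′ ≡ d → All (Valid P) F′ →
         ∃[ F ] config F ≡ c × next F ≡ F′ × All (Valid P) F
  grow [] [] eq vF = [] , refl , refl , []
  grow (done {a} ∷ ps) (inj₂ b ∷ F′) eq (_ ∷ vF) with ∷-injective eq
  ... | refl , eq′ with grow ps F′ eq′ vF
  ...   | F , refl , refl , vF′ = inj₂ a ∷ F , refl , refl , done ∷ vF′
  grow (term {a} ∷ ps) (inj₂ b ∷ F′) eq (_ ∷ vF) with ∷-injective eq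
  ... | refl , eq′ with grow ps F′ eq′ vF
  ...   | F , refl , refl , vF′ = inj₁ (leaf a) ∷ F , refl , refl , tree (leaf a) ∷ vF′
  grow (prod {A} {γ} p ∷ ps) F′ eq vF with map-++⁻ item F′ {map live γ} eq
  ... | F₁ , F₂ , refl , eq₁ , eq₂ with trees-of-lives F₁ γ eq₁
  ...   | ts , refl , refl with valid-trees⁻ ts vF
  ...     | vts , vF₂ with grow ps F₂ eq₂ vF₂
  ...       | F , refl , refl , vF′ =
    inj₁ (node A ts) ∷ F , refl , refl , tree (node p vts) ∷ vF′

  run⇒forest : ∀ {P R c z} → Run P R c z →
    ∃[ F ] config F ≡ c × yieldF F ≡ z × All (Valid P) F ×
           (∀ j → j < heightF F → R (levelF j F))
  run⇒forest (stop ts) with terminal-forest ts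
  ... | F , cF , yF , vF , h = F , cF , yF , vF , λ j j< → contradiction (subst (j <_) h j<) λ ()
  run⇒forest {R = R} (step r ps run) with run⇒forest run
  ... | F′ , cF′ , yF′ , vF′ , ctl with grow ps F′ cF′ vF′
  -- A run may continue when only terminals are left. Such steps lie beyond the height of the
  -- forest, and their control words are not asked for.
  ...   | F , refl , refl , vF = F , refl , trans (sym (yieldF-next F)) yF′ , vF , ctl′
    where
    ctl′ : ∀ j → j < heightF F → R (levelF j F)
    ctl′ zero    _  = subst R (sym (levelF-zero F)) r
    ctl′ (suc j) j< = subst R (levelF-next j F)
      (ctl j (subst (suc j ≤_) (sym (heightF-next F)) (pred-mono-≤ j<)))

module _ {k : ℕ} (G : TCG k) where
  open TCG G

  TreeRun : List (Fin k) → Set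
  TreeRun = Run rules (L-RLG control) [ live (inj₁ start) ]

  L-TCG⇒run : ∀ {z} → L-TCG G z → TreeRun z
  L-TCG⇒run {z} (t , rt , vt , yt , ctl) =
    subst₂ (Run _ _) (cong (λ r → live r ∷ []) rt) (trans (++-identityʳ _) yt)
      (forest⇒run _ (inj₁ t ∷ []) refl (tree vt ∷ [])
        λ j j< → subst (L-RLG control) (sym (++-identityʳ _))
          (ctl j (subst (suc j ≤_) (⊔-identityʳ _) j<)))

  run⇒L-TCG : ∀ {z} → TreeRun z → L-TCG G z
  run⇒L-TCG run with run⇒forest run
  ... | inj₁ t ∷ [] , cF , yF , tree vt ∷ [] , ctl =
    t , live-injective (proj₁ (∷-injective cF)) , vt , trans (sym (++-identityʳ _)) yF ,
    λ j j< → subst (L-RLG control) (++-identityʳ _)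
      (ctl j (subst (suc j ≤_) (sym (⊔-identityʳ _)) j<))
  ... | inj₂ a ∷ F , () , _

-- Finite types

record Finite (A : Set) : Set where
  field
    size    : ℕ
    enc     : A → Fin size
    dec     : Fin size → A
    dec-enc : ∀ x → dec (enc x) ≡ x

  elements : List A
  elements = map dec (allFin size)

  ∈-elements : ∀ x → x ∈ elements
  ∈-elements x = subst (_∈ elements) (dec-enc x) (∈-map⁺ dec (∈-allFin (enc x)))

  enc-injective : ∀ {x y} → enc x ≡ enc y → x ≡ y
  enc-injective eq = trans (sym (dec-enc _)) (trans (cong dec eq) (dec-enc _))

finite-Fin : ∀ n → Finite (Fin n)
finite-Fin n = record { size = n ; enc = λ i → i ; dec = λ i → i ; dec-enc = λ _ → refl }

finite-retract : ∀ {A B : Set} (f : A → B) (g : B → A) → (∀ x → g (f x) ≡ x) →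
                 Finite B → Finite A
finite-retract f g gf B = record
  { size    = Finite.size B
  ; enc     = λ x → Finite.enc B (f x)
  ; dec     = λ i → g (Finite.dec B i)
  ; dec-enc = λ x → trans (cong g (Finite.dec-enc B (f x))) (gf x)
  }

finite-⊤ : Finite ⊤
finite-⊤ = record { size = 1 ; enc = λ _ → zero ; dec = λ _ → tt ; dec-enc = λ _ → refl }

module _ {A B : Set} (F : Finite A) (G : Finite B) where
  private
    module F = Finite F
    module G = Finite G

  infixr 1 _⊎-finite_
  infixr 2 _×-finite_

  _⊎-finite_ : Finite (A ⊎ B)
  _⊎-finite_ = record
    { size    = F.size + G.size
    ; enc     = λ x → join F.size G.size (Sum.map F.enc G.enc x)
    ; dec     = λ i → Sum.map F.dec G.dec (splitAt F.size i)
    ; dec-enc = λ x → trans (cong (Sum.map F.dec G.dec)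
                                  (splitAt-join F.size G.size (Sum.map F.enc G.enc x)))
                            (retract x)
    }
    where
    retract : ∀ x → Sum.map F.dec G.dec (Sum.map F.enc G.enc x) ≡ x
    retract (inj₁ x) = cong inj₁ (F.dec-enc x)
    retract (inj₂ y) = cong inj₂ (G.dec-enc y)

  _×-finite_ : Finite (A × B)
  _×-finite_ = record
    { size    = F.size * G.size
    ; enc     = λ (x , y) → combine (F.enc x) (G.enc y)
    ; dec     = λ i → let j , l = remQuot {F.size} G.size i in F.dec j , G.dec l
    ; dec-enc = λ (x , y) → cong₂ _,_
        (trans (cong (λ p → F.dec (proj₁ p)) (remQuot-combine (F.enc x) (G.enc y))) (F.dec-enc x))
        (trans (cong (λ p → G.dec (proj₂ p)) (remQuot-combine (F.enc x) (G.enc y))) (G.dec-enc y))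
    }

finite-Bool : Finite Bool
finite-Bool = finite-retract to from retract (finite-⊤ ⊎-finite finite-⊤)
  where
  to : Bool → ⊤ ⊎ ⊤
  to true  = inj₁ tt
  to false = inj₂ tt
  from : ⊤ ⊎ ⊤ → Bool
  from (inj₁ _) = true
  from (inj₂ _) = false
  retract : ∀ b → from (to b) ≡ b
  retract true  = refl
  retract false = refl

-- Context-sensitive languages are tree-controlled

empty? : ∀ {A : Set} (xs : List A) → Dec (xs ≡ [])
empty? []       = yes refl
empty? (x ∷ xs) = no λ ()

lives-live : ∀ {m k} (w : List (Sym m k)) → lives (map live w) ≡ w
lives-live []      = refl
lives-live (x ∷ w) = cong (x ∷_) (lives-live w)

par-++ : ∀ {m k} {P : Prods m k} {c c′ d d′} → Par P c c′ → Par P d d′ → Par P (c ++ d) (c′ ++ d′)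
par-++ []                   qs = qs
par-++ (_∷_ {γ = γ} e ps) qs = subst (Par _ _) (sym (++-assoc γ _ _)) (e ∷ par-++ ps qs)

par-++⁻ : ∀ {m k} {P : Prods m k} c {d e} → Par P (c ++ d) e →
          ∃[ c′ ] ∃[ d′ ] e ≡ c′ ++ d′ × Par P c c′ × Par P d d′
par-++⁻ []      ps = [] , _ , refl , [] , ps
par-++⁻ (x ∷ c) (_∷_ {γ = γ} e ps) with par-++⁻ c ps
... | c′ , d′ , refl , ps₁ , ps₂ = γ ++ c′ , d′ , sym (++-assoc γ c′ d′) , e ∷ ps₁ , ps₂

++-middle : ∀ {A : Set} (p u l v q : List A) → p ++ (u ++ l ++ v) ++ q ≡ (p ++ u) ++ l ++ (v ++ q)
++-middle p u l v q = begin
  p ++ (u ++ l ++ v) ++ q ≡⟨ cong (p ++_) (++-assoc u (l ++ v) q) ⟩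
  p ++ u ++ (l ++ v) ++ q ≡⟨ cong (λ w → p ++ u ++ w) (++-assoc l v q) ⟩
  p ++ u ++ l ++ v ++ q   ≡⟨ sym (++-assoc p u (l ++ v ++ q)) ⟩
  (p ++ u) ++ l ++ v ++ q ∎
  where open ≡-Reasoning

singleton-middle : ∀ {A : Set} (u : List A) {x v y} → u ++ x ∷ v ≡ [ y ] → u ≡ [] × x ≡ y × v ≡ []
singleton-middle []      refl = refl , refl , refl
singleton-middle (_ ∷ u) eq with () ← ++-conicalʳ u _ (proj₂ (∷-injective eq))

module _ {k : ℕ} (G : CSG k) where
  open CSG G using (rules)

  cs-context : ∀ p q {x y} → CSStep G x y → CSStep G (p ++ x ++ q) (p ++ y ++ q)
  cs-context p q (apply {r} u v r∈) =
    subst₂ (CSStep G) (sym (++-middle p u (lhs r) v q)) (sym (++-middle p u (rhs r) v q))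
      (apply (p ++ u) (v ++ q) r∈)

  cs-++ : ∀ {x x′ y y′} → Star (CSStep G) x x′ → Star (CSStep G) y y′ →
          Star (CSStep G) (x ++ y) (x′ ++ y′)
  cs-++ {x} {x′} {y} {y′} xs ys =
    gmap (_++ y) (λ s → cs-context [] y s) xs ◅◅
    subst₂ (Star (CSStep G)) (cong (x′ ++_) (++-identityʳ y)) (cong (x′ ++_) (++-identityʳ y′))
      (gmap (λ w → x′ ++ w ++ []) (cs-context x′ []) ys)

  cs-rule : ∀ {r} → r ∈ rules → CSStep G (lhs r) (rhs r)
  cs-rule {r} r∈ = subst₂ (CSStep G) (++-identityʳ (lhs r)) (++-identityʳ (rhs r)) (apply [] [] r∈)

-- The level words of the tree-controlled grammar are sentential forms in which some occurrences
-- of a left-hand nonterminal A are replaced by the mark of a rule αAβ → αγβ.  The control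
-- language {start, X, α mark β}* forces every mark to stand in its context; on the next level
-- the marks are expanded and the contexts copied.
module ToTreeControlled {k : ℕ} (G : CSG k) where
  open CSG G renaming (nts to m; start to S; rules to csrules)

  rule : Fin (length csrules) → CSRule m k
  rule = lookup csrules

  leftCtx rightCtx body : Fin (length csrules) → List (Sym m k)
  leftCtx i  = proj₁ (rule i)
  rightCtx i = proj₁ (proj₂ (proj₂ (rule i)))
  body i     = proj₂ (proj₂ (proj₂ (rule i)))

  head : Fin (length csrules) → Sym m k
  head i = inj₁ (proj₁ (proj₂ (rule i)))

  -- A fresh `start` is needed because every `plain X`, that of `S` included, is copied and so
  -- occurs on a right-hand side, where an erasable symbol must not occur. Terminals get a `plain`
  -- version too: a genuine terminal is a leaf, and it would be missing from later levels in which
  -- it has to serve as context.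
  data Node : Set where
    start : Node
    plain : Sym m k → Node
    mark  : Fin (length csrules) → Node

  abstract
    finite-Sym : Finite (Sym m k)
    finite-Sym = finite-Fin m ⊎-finite finite-Fin k

    finite-Node : Finite Node
    finite-Node = finite-retract to from retract (finite-⊤ ⊎-finite finite-Sym ⊎-finite finite-Fin _)
      where
      to : Node → ⊤ ⊎ Sym m k ⊎ Fin (length csrules)
      to start     = inj₁ tt
      to (plain X) = inj₂ (inj₁ X)
      to (mark i)  = inj₂ (inj₂ i)
      from : ⊤ ⊎ Sym m k ⊎ Fin (length csrules) → Node
      from (inj₁ _)        = start
      from (inj₂ (inj₁ X)) = plain X
      from (inj₂ (inj₂ i)) = mark i
      retract : ∀ x → from (to x) ≡ x
      retract start     = refl
      retract (plain X) = refl
      retract (mark i)  = refl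

  open Finite finite-Node renaming (size to M)
  open Finite finite-Sym using () renaming (elements to symbols; ∈-elements to ∈-symbols)

  nt : Node → Sym M k
  nt n = inj₁ (enc n)

  bar : Sym m k → Sym M k
  bar X = nt (plain X)

  nonErasingRules erasingRules : List (Fin (length csrules))
  nonErasingRules = filter (λ i → ¬? (empty? (body i))) (allFin _)
  erasingRules    = filter (λ i → empty? (body i)) (allFin _)

  data Prod : Node → List (Sym M k) → Set where
    init   : Prod start [ bar (inj₁ S) ]
    erase  : ∀ i → body i ≡ [] → Prod start []
    copy   : ∀ X → Prod (plain X) [ bar X ]
    select : ∀ i → body i ≢ [] → Prod (plain (head i)) [ nt (mark i) ]
    expand : ∀ i → body i ≢ [] → Prod (mark i) (map bar (body i))
    emit   : ∀ a → Prod (plain (inj₂ a)) [ inj₂ a ]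

  selectProd expandProd : Fin (length csrules) → Fin M × List (Sym M k)
  selectProd i = enc (plain (head i)) , [ nt (mark i) ]
  expandProd i = enc (mark i) , map bar (body i)

  copyProd : Sym m k → Fin M × List (Sym M k)
  copyProd X = enc (plain X) , [ bar X ]

  emitProd : Fin k → Fin M × List (Sym M k)
  emitProd a = enc (plain (inj₂ a)) , [ inj₂ a ]

  erases copies selects expands emits prods : Prods M k
  erases  = map (λ i → enc start , []) erasingRules
  copies  = map copyProd symbols
  selects = map selectProd nonErasingRules
  expands = map expandProd nonErasingRules
  emits   = map emitProd (allFin k)
  prods   = (enc start , [ bar (inj₁ S) ]) ∷ erases ++ copies ++ selects ++ expands ++ emits

  ∈-nonErasing⁺ : ∀ i → body i ≢ [] → i ∈ nonErasingRules
  ∈-nonErasing⁺ i = ∈-filter⁺ (λ i → ¬? (empty? (body i))) (∈-allFin i)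

  ∈-nonErasing⁻ : ∀ {i} → i ∈ nonErasingRules → body i ≢ []
  ∈-nonErasing⁻ i∈ = proj₂ (∈-filter⁻ (λ i → ¬? (empty? (body i))) {xs = allFin _} i∈)

  prod⁺ : ∀ {n γ} → Prod n γ → (enc n , γ) ∈ prods
  prod⁺ init         = here refl
  prod⁺ (erase i e)  = there (∈-++⁺ˡ (∈-map⁺ (λ i → enc start , [])
    (∈-filter⁺ (λ i → empty? (body i)) (∈-allFin i) e)))
  prod⁺ (copy X)     = there (∈-++⁺ʳ erases (∈-++⁺ˡ (∈-map⁺ copyProd (∈-symbols X))))
  prod⁺ (select i e) = there (∈-++⁺ʳ erases (∈-++⁺ʳ copies (∈-++⁺ˡ
    (∈-map⁺ selectProd (∈-nonErasing⁺ i e)))))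
  prod⁺ (expand i e) = there (∈-++⁺ʳ erases (∈-++⁺ʳ copies (∈-++⁺ʳ selects (∈-++⁺ˡ
    (∈-map⁺ expandProd (∈-nonErasing⁺ i e))))))
  prod⁺ (emit a)     = there (∈-++⁺ʳ erases (∈-++⁺ʳ copies (∈-++⁺ʳ selects (∈-++⁺ʳ expands
    (∈-map⁺ emitProd (∈-allFin a))))))

  prod⁻ : ∀ {j γ} → (j , γ) ∈ prods → ∃[ n ] j ≡ enc n × Prod n γ
  prod⁻ (here refl) = _ , refl , init
  prod⁻ (there p) with ∈-++⁻ erases p
  ... | inj₁ q with ∈-map⁻ _ q
  ...   | i , i∈ , refl =
    _ , refl , erase i (proj₂ (∈-filter⁻ (λ i → empty? (body i)) {xs = allFin _} i∈))
  prod⁻ (there p) | inj₂ q with ∈-++⁻ copies q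
  ... | inj₁ q₁ with ∈-map⁻ copyProd q₁
  ...   | X , _ , refl = _ , refl , copy X
  prod⁻ (there p) | inj₂ q | inj₂ q₁ with ∈-++⁻ selects q₁
  ... | inj₁ q₂ with ∈-map⁻ selectProd q₂
  ...   | i , i∈ , refl = _ , refl , select i (∈-nonErasing⁻ i∈)
  prod⁻ (there p) | inj₂ q | inj₂ q₁ | inj₂ q₂ with ∈-++⁻ expands q₂
  ... | inj₁ q₃ with ∈-map⁻ expandProd q₃
  ...   | i , i∈ , refl = _ , refl , expand i (∈-nonErasing⁻ i∈)
  prod⁻ (there p) | inj₂ q | inj₂ q₁ | inj₂ q₂ | inj₂ q₃ with ∈-map⁻ emitProd q₃
  ... | a , _ , refl = _ , refl , emit a

  prod-enc⁻ : ∀ {n γ} → (enc n , γ) ∈ prods → Prod n γ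
  prod-enc⁻ p with prod⁻ p
  ... | n , eq , q = subst (λ n → Prod n _) (sym (enc-injective eq)) q

  factor : Fin (length csrules) → List (Sym M k)
  factor i = map bar (leftCtx i) ++ nt (mark i) ∷ map bar (rightCtx i)

  -- No factor contains a genuine terminal. A level on which one appears must therefore be the last,
  -- so all terminals are emitted simultaneously and `done` items never arise in these runs.
  data Factor : List (Sym M k) → Set where
    start : Factor [ nt start ]
    plain : ∀ X → Factor [ bar X ]
    mark  : ∀ i → Factor (factor i)

  factors : List (List (Sym M k))
  factors = [ nt start ] ∷ map (λ X → [ bar X ]) symbols ++ map factor (allFin _)

  factor⁺ : ∀ {ω} → Factor ω → ω ∈ factors
  factor⁺ start     = here refl
  factor⁺ (plain X) = there (∈-++⁺ˡ (∈-map⁺ _ (∈-symbols X)))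
  factor⁺ (mark i)  = there (∈-++⁺ʳ _ (∈-map⁺ factor (∈-allFin i)))

  factor⁻ : ∀ {ω} → ω ∈ factors → Factor ω
  factor⁻ (here refl) = start
  factor⁻ (there p) with ∈-++⁻ (map (λ X → [ bar X ]) symbols) p
  ... | inj₁ q with ∈-map⁻ _ q
  ...   | X , _ , refl = plain X
  factor⁻ (there p) | inj₂ q with ∈-map⁻ factor q
  ... | i , _ , refl = mark i

  control : RLG (Sym M k)
  control = record
    { nts   = 1
    ; start = zero
    ; rules = (zero , [] , nothing) ∷ map (λ ω → zero , ω , just zero) factors
    }

  data Factors : List (Sym M k) → Set where
    []  : Factors []
    _∷_ : ∀ {ω w} → Factor ω → Factors w → Factors (ω ++ w)

  factors⇒control : ∀ {w} → Factors w → L-RLG control w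
  factors⇒control []       = stop (here refl)
  factors⇒control (f ∷ fs) = step (there (∈-map⁺ _ (factor⁺ f))) (factors⇒control fs)

  control⇒factors : ∀ {w} → RLDerives control zero w → Factors w
  control⇒factors (stop (here refl)) = []
  control⇒factors (stop (there p)) with ∈-map⁻ _ p
  ... | _ , _ , ()
  control⇒factors (step (here ()) _)
  control⇒factors (step (there p) d) with ∈-map⁻ _ p
  ... | ω , ω∈ , refl = factor⁻ ω∈ ∷ control⇒factors d

  erasing-is-start : ∀ {n γ} → Prod n γ → γ ≡ [] → n ≡ start
  erasing-is-start (erase i _)  _ = refl
  erasing-is-start (expand i e) p with body i
  ... | []    = contradiction refl e
  erasing-is-start (expand i e) () | _ ∷ _

  nt-injective : ∀ {n n′} → nt n ≡ nt n′ → n ≡ n′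
  nt-injective eq = enc-injective (inj₁-injective eq)

  start∉bars : ∀ w → nt start ∉ map bar w
  start∉bars w p with ∈-map⁻ bar p
  ... | X , _ , eq with () ← nt-injective eq

  start-fresh : ∀ {n γ} → Prod n γ → nt start ∉ γ
  start-fresh init         = start∉bars [ inj₁ S ]
  start-fresh (erase i _)  ()
  start-fresh (copy X)     = start∉bars [ X ]
  start-fresh (select i _) (here eq) with () ← nt-injective eq
  start-fresh (expand i _) = start∉bars (body i)
  start-fresh (emit a)     (here ())

  grammar : TCG k
  grammar = record
    { nts        = M
    ; start      = enc start
    ; rules      = prods
    ; nonErasing = All.tabulate λ r∈ γ≡[] → erasing r∈ γ≡[] ,
        All.tabulate λ r′∈ → start-fresh (proj₂ (proj₂ (prod⁻ r′∈)))
    ; control    = control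
    }
    where
    erasing : ∀ {j γ} → (j , γ) ∈ prods → γ ≡ [] → j ≡ enc start
    erasing r∈ γ≡[] with prod⁻ r∈
    ... | n , refl , p = cong enc (erasing-is-start p γ≡[])

  -- A mark is read as the nonterminal that it replaced, so the rule counts as applied only when the
  -- mark is expanded. With this reading `init`, `copy`, `select` and `emit` all leave the word
  -- unchanged.
  decode : Sym M k → Sym m k
  decode (inj₁ j) = decodeNode (dec j)
    where
    decodeNode : Node → Sym m k
    decodeNode start     = inj₁ S
    decodeNode (plain X) = X
    decodeNode (mark i)  = head i
  decode (inj₂ a) = inj₂ a

  decode-bar : ∀ X → decode (bar X) ≡ X
  decode-bar X rewrite dec-enc (plain X) = refl

  decode-bars : ∀ w → map decode (map bar w) ≡ w
  decode-bars []      = refl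
  decode-bars (X ∷ w) = cong₂ _∷_ (decode-bar X) (decode-bars w)

  decode-factor : ∀ i → map decode (factor i) ≡ lhs (rule i)
  decode-factor i rewrite map-++ decode (map bar (leftCtx i)) (nt (mark i) ∷ map bar (rightCtx i))
                        | decode-bars (leftCtx i) | decode-bars (rightCtx i)
                        | dec-enc (mark i) = refl

  -- From runs to context-sensitive derivations

  erasing-rule : ∀ i → body i ≡ [] → CSStep G [ inj₁ S ] []
  erasing-rule i eq with All.lookup wellFormed (∈-lookup {xs = csrules} i) eq
  ... | (α≡[] , A≡S , β≡[]) , _ = subst₂ (CSStep G)
    (trans (cong₂ _++_ α≡[] (cong₂ _∷_ (cong inj₁ A≡S) β≡[])) refl)
    (cong₂ _++_ α≡[] (cong₂ _++_ eq β≡[]))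
    (cs-rule G (∈-lookup {xs = csrules} i))

  _⇒*_ : List (Sym m k) → List (Sym m k) → Set
  _⇒*_ = Star (CSStep G)

  ≡⇒* : ∀ {v w} → v ≡ w → v ⇒* w
  ≡⇒* refl = ε

  par-bars⁻ : ∀ w {d} → Par prods (map live (map bar w)) d →
              ∃[ w′ ] d ≡ map live w′ × map decode w′ ≡ w
  par-bars⁻ []      []             = [] , refl , refl
  par-bars⁻ (X ∷ w) (prod p ∷ ps) with prod-enc⁻ p | par-bars⁻ w ps
  ... | copy X     | w′ , refl , eq = bar X ∷ w′ , refl , cong₂ _∷_ (decode-bar X) eq
  ... | emit a     | w′ , refl , eq = inj₂ a ∷ w′ , refl , cong (inj₂ a ∷_) eq
  ... | select i _ | w′ , refl , eq = nt (mark i) ∷ w′ , refl , cong₂ _∷_ head≡ eq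
    where
    head≡ : decode (nt (mark i)) ≡ head i
    head≡ rewrite dec-enc (mark i) = refl

  -- While a mark is expanded, the symbols of its context may be copied, emitted or selected for
  -- another rule. None of this changes their decoded form, so a marked factor amounts to exactly
  -- one application of its rule.
  par-factor⁻ : ∀ {ω d} → Factor ω → Par prods (map live ω) d →
                ∃[ w ] d ≡ map live w × map decode ω ⇒* map decode w
  par-factor⁻ start (prod p ∷ []) with prod-enc⁻ p
  ... | init rewrite dec-enc start = _ , refl , ≡⇒* (sym (decode-bars [ inj₁ S ]))
  ... | erase i eq rewrite dec-enc start = [] , refl , erasing-rule i eq ◅ ε
  par-factor⁻ (plain X) ps with par-bars⁻ [ X ] ps
  ... | w , eq , eq′ = w , eq , ≡⇒* (trans (decode-bars [ X ]) (sym eq′))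
  par-factor⁻ (mark i) ps rewrite map-++ Item.live (map bar (leftCtx i)) (nt (mark i) ∷ map bar (rightCtx i))
    with par-++⁻ (map live (map bar (leftCtx i))) ps
  ... | _ , _ , refl , ps₁ , prod p ∷ ps₂ with par-bars⁻ _ ps₁ | prod-enc⁻ p | par-bars⁻ _ ps₂
  ...   | α , refl , eq₁ | expand i _ | β , refl , eq₂ =
    α ++ map bar (body i) ++ β ,
    sym (trans (map-++ live α _) (cong (_ ++_) (map-++ live (map bar (body i)) β))) ,
    subst₂ _⇒*_ (sym (decode-factor i)) (sym decoded) (cs-rule G (∈-lookup {xs = csrules} i) ◅ ε)
    where
    decoded : map decode (α ++ map bar (body i) ++ β) ≡ rhs (rule i)
    decoded rewrite map-++ decode α (map bar (body i) ++ β) | map-++ decode (map bar (body i)) β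
                  | decode-bars (body i) | eq₁ | eq₂ = refl

  -- The factors of a level are disjoint, hence the rules expanded on it in parallel can be applied
  -- one after the other.
  par-factors⁻ : ∀ {w d} → Factors w → Par prods (map live w) d →
                 ∃[ w′ ] d ≡ map live w′ × map decode w ⇒* map decode w′
  par-factors⁻ []                []  = [] , refl , ε
  par-factors⁻ (_∷_ {ω} {w} f fs) ps rewrite map-++ Item.live ω w | map-++ decode ω w
    with par-++⁻ (map live ω) ps
  ... | _ , _ , refl , ps₁ , ps₂ with par-factor⁻ f ps₁ | par-factors⁻ fs ps₂
  ...   | w₁ , refl , s₁ | w₂ , refl , s₂ =
    w₁ ++ w₂ , sym (map-++ live w₁ w₂) ,
    cs-++ G s₁ s₂ ◅◅ ≡⇒* (sym (map-++ decode w₁ w₂))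

  terminal-live : ∀ w {z} → Pointwise Terminal (map live w) z → map decode w ≡ map inj₂ z
  terminal-live []           []          = refl
  terminal-live (inj₂ a ∷ w) (live ∷ ts) = cong (inj₂ a ∷_) (terminal-live w ts)

  run⇒derivation : ∀ {c z} → Run prods (L-RLG control) c z → ∀ w → c ≡ map live w →
                   map decode w ⇒* map inj₂ z
  run⇒derivation (stop ts)       w refl = ≡⇒* (terminal-live w ts)
  run⇒derivation (step r ps run) w refl
    with par-factors⁻ (control⇒factors (subst (RLDerives control zero) (lives-live w) r)) ps
  ... | w′ , refl , s = s ◅◅ run⇒derivation run w′ refl

  L-TCG⇒L-CSG : ∀ {z} → L-TCG grammar z → L-CSG G z
  L-TCG⇒L-CSG d = ≡⇒* (sym start≡) ◅◅ run⇒derivation (L-TCG⇒run grammar d) [ nt start ] refl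
    where
    start≡ : map decode [ nt start ] ≡ [ inj₁ S ]
    start≡ rewrite dec-enc start = refl

  -- From context-sensitive derivations to runs

  barred : List (Sym m k) → List (Item M k)
  barred w = map live (map bar w)

  barred-++ : ∀ u v → barred (u ++ v) ≡ barred u ++ barred v
  barred-++ u v = trans (cong (map live) (map-++ bar u v)) (map-++ live (map bar u) (map bar v))

  factors-++ : ∀ {u v} → Factors u → Factors v → Factors (u ++ v)
  factors-++ []                 gs = gs
  factors-++ (_∷_ {ω} {w} f fs) gs = subst Factors (sym (++-assoc ω w _)) (f ∷ factors-++ fs gs)

  bars-factors : ∀ w → Factors (map bar w)
  bars-factors []      = []
  bars-factors (X ∷ w) = plain X ∷ bars-factors w

  copy-par : ∀ w → Par prods (barred w) (barred w)
  copy-par []      = []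
  copy-par (X ∷ w) = prod (prod⁺ (copy X)) ∷ copy-par w

  TreeRun′ : List (Item M k) → List (Fin k) → Set
  TreeRun′ = Run prods (L-RLG control)

  live-step : ∀ {w d z} → Factors w → Par prods (map live w) d → TreeRun′ d z → TreeRun′ (map live w) z
  live-step {w} fs = step (subst (L-RLG control) (sym (lives-live w)) (factors⇒control fs))

  rule-run : ∀ i u v {z} → body i ≢ [] → TreeRun′ (barred (u ++ rhs (rule i) ++ v)) z →
             TreeRun′ (barred (u ++ lhs (rule i) ++ v)) z
  rule-run i u v ne run = live-step (bars-factors _) select-par
    (live-step (factors-++ (bars-factors u) (mark i ∷ bars-factors v)) expand-par run)
    where
    α = leftCtx i
    β = rightCtx i
    marked : map live (factor i) ≡ barred α ++ live (nt (mark i)) ∷ barred β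
    marked = map-++ live (map bar α) _
    in-context : ∀ {c d} → Par prods c d → Par prods (barred u ++ c ++ barred v) (barred u ++ d ++ barred v)
    in-context ps = par-++ (copy-par u) (par-++ ps (copy-par v))
    barred-context : ∀ w → barred u ++ barred w ++ barred v ≡ barred (u ++ w ++ v)
    barred-context w = sym (trans (barred-++ u (w ++ v)) (cong (barred u ++_) (barred-++ w v)))
    factor-context : barred u ++ map live (factor i) ++ barred v ≡ map live (map bar u ++ factor i ++ map bar v)
    factor-context = sym (trans (map-++ live (map bar u) _) (cong (barred u ++_) (map-++ live (factor i) _)))
    select-par : Par prods (barred (u ++ lhs (rule i) ++ v)) (map live (map bar u ++ factor i ++ map bar v))
    select-par = subst₂ (Par prods) (barred-context (lhs (rule i))) factor-context
      (in-context (subst₂ (Par prods) (sym (barred-++ α _)) (sym marked)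
        (par-++ (copy-par α) (prod (prod⁺ (select i ne)) ∷ copy-par β))))
    expand-par : Par prods (map live (map bar u ++ factor i ++ map bar v)) (barred (u ++ rhs (rule i) ++ v))
    expand-par = subst₂ (Par prods) factor-context (barred-context (rhs (rule i)))
      (in-context (subst₂ (Par prods) (sym marked)
        (sym (trans (barred-++ α _) (cong (barred α ++_) (barred-++ (body i) β))))
        (par-++ (copy-par α) (prod (prod⁺ (expand i ne)) ∷ copy-par β))))

  emit-run : ∀ z → TreeRun′ (barred (map inj₂ z)) z
  -- The level of genuine terminals is the last one and escapes the control, which would reject it
  -- unless it is empty.
  emit-run z = live-step (bars-factors _) (emit-par z) (stop (terminals z))
    where
    emit-par : ∀ z → Par prods (barred (map inj₂ z)) (map live (map inj₂ z))
    emit-par []      = []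
    emit-par (a ∷ z) = prod (prod⁺ (emit a)) ∷ emit-par z
    terminals : ∀ z → Pointwise Terminal (map live (map inj₂ z)) z
    terminals []      = []
    terminals (a ∷ z) = live ∷ terminals z

  -- If some rule erases `S`, then `S` is on no right-hand side. The condition thus holds as soon as
  -- one non-erasing rule has been applied to the start symbol, it is preserved by every step, and
  -- it excludes any later use of an erasing rule.
  ErasureFree : List (Sym m k) → Set
  ErasureFree w = ∀ i → body i ≡ [] → inj₁ S ∉ w

  rhs-erasureFree : ∀ i → ErasureFree (rhs (rule i))
  rhs-erasureFree i j eq =
    All.lookup (proj₂ (All.lookup wellFormed (∈-lookup {xs = csrules} j) eq)) (∈-lookup {xs = csrules} i)

  erased-head : ∀ i → body i ≡ [] → inj₁ S ∈ lhs (rule i)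
  erased-head i eq with All.lookup wellFormed (∈-lookup {xs = csrules} i) eq
  ... | (_ , A≡S , _) , _ = ∈-++⁺ʳ (leftCtx i) (here (cong inj₁ (sym A≡S)))

  derivation⇒run : ∀ {w v} → w ⇒* v → ∀ {z} → v ≡ map inj₂ z → ErasureFree w → TreeRun′ (barred w) z
  derivation⇒run ε refl _ = emit-run _
  derivation⇒run (apply {r} u v r∈ ◅ d) eq free with index r∈ | lookup-index r∈
  ... | i | refl = rule-run i u v (λ e → free i e (∈-++⁺ʳ u (∈-++⁺ˡ (erased-head i e))))
    (derivation⇒run d eq λ j e p → case-∈ j e (∈-++⁻ u p))
    where
    case-∈ : ∀ j → body j ≡ [] → inj₁ S ∈ u ⊎ inj₁ S ∈ rhs (rule i) ++ v → ⊥
    case-∈ j e (inj₁ p) = free j e (∈-++⁺ˡ p)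
    case-∈ j e (inj₂ p) with ∈-++⁻ (rhs (rule i)) p
    ... | inj₁ q = rhs-erasureFree i j e q
    ... | inj₂ q = free j e (∈-++⁺ʳ u (∈-++⁺ʳ (lhs (rule i)) q))

  derives-from-[] : ∀ {w v} → w ⇒* v → w ≡ [] → v ≡ []
  derives-from-[] ε eq = eq
  derives-from-[] (apply {α , A , β , γ} u v _ ◅ d) eq
    with () ← ++-conicalʳ α _ (++-conicalˡ _ v (++-conicalʳ u _ eq))

  singleton-lhs : ∀ u (r : CSRule m k) v {X} → u ++ lhs r ++ v ≡ [ X ] →
                  u ≡ [] × lhs r ≡ [ X ] × v ≡ []
  singleton-lhs (_ ∷ u) (α , A , β , γ) v eq
    with () ← ++-conicalʳ α _ (++-conicalˡ _ v (++-conicalʳ u _ (proj₂ (∷-injective eq))))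
  singleton-lhs [] (_ ∷ α , A , β , γ) v eq
    with () ← ++-conicalʳ α _ (++-conicalˡ _ v (proj₂ (∷-injective eq)))
  singleton-lhs [] ([] , A , β , γ) v eq with ∷-injective eq
  ... | refl , eq′ = refl , cong (_ ∷_) (++-conicalˡ β v eq′) , ++-conicalʳ β v eq′

  -- The first step is taken separately, being the only one that can erase: an erasing rule becomes
  -- `erase` on `start`, after which nothing can be derived. Otherwise the run begins with `init`,
  -- and the word after the first rule is a right-hand side, hence erasure-free.
  L-CSG⇒L-TCG : ∀ {z} → L-CSG G z → L-TCG grammar z
  L-CSG⇒L-TCG d = run⇒L-TCG grammar (initial d refl refl)
    where
    start-step : ∀ {d z} → Par prods [ live (nt start) ] d → TreeRun′ d z →
                 TreeRun′ [ live (nt start) ] z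
    start-step = live-step (start ∷ [])
    initial : ∀ {w v} → w ⇒* v → w ≡ [ inj₁ S ] → ∀ {z} → v ≡ map inj₂ z →
              TreeRun′ [ live (nt start) ] z
    initial ε refl {[]} ()
    initial ε refl {_ ∷ _} ()
    initial (apply u v r∈ ◅ d) eq eq′ with index r∈ | lookup-index r∈
    ... | i | refl with singleton-lhs u (rule i) v eq
    ...   | refl , lhs≡ , refl with empty? (body i)
    ...     | no ne = start-step (prod (prod⁺ init) ∷ [])
      (subst TreeRun″ (trans (++-identityʳ _) lhs≡)
        (rule-run i [] [] ne (derivation⇒run d eq′
          (subst ErasureFree (sym (++-identityʳ _)) (rhs-erasureFree i)))))
      where
      TreeRun″ : List (Sym m k) → Set
      TreeRun″ w = TreeRun′ (barred w) _
    ...     | yes e = erased (trans (sym eq′) (derives-from-[] d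
      (trans (++-identityʳ _) (cong₂ _++_ α≡[] (cong₂ _++_ e β≡[])))))
      where
      context = proj₁ (All.lookup wellFormed (∈-lookup {xs = csrules} i) e)
      α≡[] = proj₁ context
      β≡[] = proj₂ (proj₂ context)
      erased : ∀ {z} → map inj₂ z ≡ [] → TreeRun′ [ live (nt start) ] z
      erased {[]} _ = start-step (prod (prod⁺ (erase i e)) ∷ []) (stop [])

-- Finite automata

module _ {A : Set} (R : A → A → Set) where

  -- Warshall: only points of the given list occur between i and j.
  Via : List A → A → A → Set
  Via []       i j = i ≡ j ⊎ R i j
  Via (x ∷ xs) i j = Via xs i j ⊎ (Via xs i x × Via xs x j)

  -- The two walks are joined after cutting out a closed detour: if both pass through the newest
  -- point, only the leg before it in the first walk and the leg after it in the second are kept.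
  via-trans : ∀ {xs i j x} → x ∈ xs → Via xs i x → Via xs x j → Via xs i j
  via-trans (here refl) (inj₁ p)       (inj₁ q)       = inj₂ (p , q)
  via-trans (here refl) (inj₁ p)       (inj₂ (_ , q)) = inj₂ (p , q)
  via-trans (here refl) (inj₂ (p , _)) (inj₁ q)       = inj₂ (p , q)
  via-trans (here refl) (inj₂ (p , _)) (inj₂ (_ , q)) = inj₂ (p , q)
  via-trans (there x∈)  (inj₁ p)       (inj₁ q)       = inj₁ (via-trans x∈ p q)
  via-trans (there x∈)  (inj₁ p)       (inj₂ (q , r)) = inj₂ (via-trans x∈ p q , r)
  via-trans (there x∈)  (inj₂ (p , q)) (inj₁ r)       = inj₂ (p , via-trans x∈ q r)
  via-trans (there x∈)  (inj₂ (p , _)) (inj₂ (_ , r)) = inj₂ (p , r)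

  via⇒star : ∀ xs {i j} → Via xs i j → Star R i j
  via⇒star []       (inj₁ refl)    = ε
  via⇒star []       (inj₂ r)       = r ◅ ε
  via⇒star (x ∷ xs) (inj₁ p)       = via⇒star xs p
  via⇒star (x ∷ xs) (inj₂ (p , q)) = via⇒star xs p ◅◅ via⇒star xs q

  via-mono : ∀ xs {i j} → Via [] i j → Via xs i j
  via-mono []       p = p
  via-mono (x ∷ xs) p = inj₁ (via-mono xs p)

  star⇒via : ∀ {xs} → (∀ x → x ∈ xs) → ∀ {i j} → Star R i j → Via xs i j
  star⇒via {xs} all ε       = via-mono xs (inj₁ refl)
  star⇒via {xs} all (r ◅ s) = via-trans (all _) (via-mono xs (inj₂ r)) (star⇒via all s)

  via? : DecidableEquality A → Decidable R → ∀ xs → Decidable (Via xs)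
  via? _≟_ R? []       i j = i ≟ j ⊎-dec R? i j
  via? _≟_ R? (x ∷ xs) i j =
    via? _≟_ R? xs i j ⊎-dec (via? _≟_ R? xs i x ×-dec via? _≟_ R? xs x j)

-- Rules A → B without letters can be chained, so the silent moves between two letters have no
-- evident bound on their number; deciding them needs a reachability test.
star? : ∀ {n} {R : Fin n → Fin n → Set} → Decidable R → Decidable (Star R)
star? {n} {R} R? i j =
  map′ (via⇒star R (allFin n)) (star⇒via R ∈-allFin) (via? R Fin._≟_ R? (allFin n) i j)

record NFA (X : Set) : Set₁ where
  field
    size   : ℕ
    init   : Fin size
    Trans  : Fin size → X → Fin size → Set
    trans? : ∀ q x q′ → Dec (Trans q x q′)
    Final  : Fin size → Set
    final? : ∀ q → Dec (Final q)

  data Accepts : Fin size → List X → Set where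
    []  : ∀ {q} → Final q → Accepts q []
    _∷_ : ∀ {q x q′ w} → Trans q x q′ → Accepts q′ w → Accepts q (x ∷ w)

  accepts? : ∀ q w → Dec (Accepts q w)
  accepts? q []      = map′ [] (λ { ([] f) → f }) (final? q)
  accepts? q (x ∷ w) = map′ (λ (_ , t , a) → t ∷ a) (λ { (t ∷ a) → _ , t , a })
                            (any? λ q′ → trans? q x q′ ×-dec accepts? q′ w)

-- The states are the unread suffixes w of the right-hand sides wB and w of rules.
module ToNFA {X : Set} (_≟_ : DecidableEquality X) (H : RLG X) where
  open RLG H

  State : Set
  State = List X × Maybe (Fin nts)

  data Reads : State → List X → Set where
    stop : Reads ([] , nothing) []
    call : ∀ {B s v} → (B , s) ∈ rules → Reads s v → Reads ([] , just B) v
    read : ∀ {x w c v} → Reads (w , c) v → Reads (x ∷ w , c) (x ∷ v)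

  reads-prefix : ∀ w {c v} → Reads ([] , c) v → Reads (w , c) (w ++ v)
  reads-prefix []      r = r
  reads-prefix (x ∷ w) r = read (reads-prefix w r)

  derives⇒reads : ∀ {A v} → RLDerives H A v → Reads ([] , just A) v
  derives⇒reads (stop {w = w} r∈)   = call r∈ (subst (Reads _) (List.++-identityʳ w) (reads-prefix w stop))
  derives⇒reads (step {w = w} r∈ d) = call r∈ (reads-prefix w (derives⇒reads d))

  -- The meaning of a half-read right-hand side. Induction over `Reads` passes through such states,
  -- so a statement about nonterminals alone would not be inductive.
  Denotes : State → List X → Set
  Denotes (w , nothing) v = v ≡ w
  Denotes (w , just B)  v = ∃[ u ] v ≡ w ++ u × RLDerives H B u

  reads⇒denotes : ∀ {s v} → Reads s v → Denotes s v
  reads⇒denotes stop = refl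
  reads⇒denotes (call {s = w , nothing} r∈ r) with refl ← reads⇒denotes r = _ , refl , stop r∈
  reads⇒denotes (call {s = w , just B} r∈ r) with _ , refl , d ← reads⇒denotes r = _ , refl , step r∈ d
  reads⇒denotes (read {c = nothing} r) = cong (_ ∷_) (reads⇒denotes r)
  reads⇒denotes (read {c = just B} r) with _ , refl , d ← reads⇒denotes r = _ , refl , d

  suffixes : List X → Maybe (Fin nts) → List State
  suffixes []      c = [ [] , c ]
  suffixes (x ∷ w) c = (x ∷ w , c) ∷ suffixes w c

  suffixes-self : ∀ w c → (w , c) ∈ suffixes w c
  suffixes-self []      c = here refl
  suffixes-self (x ∷ w) c = here refl

  suffixes-tail : ∀ w c {x w′ c′} → (x ∷ w′ , c′) ∈ suffixes w c → (w′ , c′) ∈ suffixes w c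
  suffixes-tail []      c (here ())
  suffixes-tail (x ∷ w) c (here refl) = there (suffixes-self w c)
  suffixes-tail (x ∷ w) c (there p)   = there (suffixes-tail w c p)

  states : List State
  states = ([] , just start) ∷ concatMap (λ (_ , w , c) → suffixes w c) rules

  called-state : ∀ {B w c} → (B , w , c) ∈ rules → (w , c) ∈ states
  called-state r∈ = there (∈-concatMap⁺ _ (lose r∈ (suffixes-self _ _)))

  tail-state : ∀ {x w c} → (x ∷ w , c) ∈ states → (w , c) ∈ states
  tail-state (here ())
  tail-state (there p) with find (∈-concatMap⁻ (λ (_ , w , c) → suffixes w c) {xs = rules} p)
  ... | (_ , w , c) , r∈ , q = there (∈-concatMap⁺ _ (lose r∈ (suffixes-tail w c q)))

  _≟S_ : DecidableEquality State
  _≟S_ = Product.≡-dec (List.≡-dec _≟_) (Maybe.≡-dec Fin._≟_)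

  open DecMembership (Product.≡-dec (Fin._≟_ {nts}) _≟S_) using (_∈?_)

  state : Fin (length states) → State
  state = lookup states

  Silent : Fin (length states) → Fin (length states) → Set
  Silent i j = ∃[ B ] state i ≡ ([] , just B) × (B , state j) ∈ rules

  Read : Fin (length states) → X → Fin (length states) → Set
  Read i x j = state i ≡ (x ∷ proj₁ (state j) , proj₂ (state j))

  nfa : NFA X
  nfa = record
    { size   = length states
    ; init   = zero
    -- Silent moves are absorbed in front of each letter and of acceptance, so every transition
    -- reads exactly one symbol, as the sweeping head requires.
    ; Trans  = λ i x j → ∃[ l ] Star Silent i l × Read l x j
    ; trans? = λ i x j → any? λ l → silent*? i l ×-dec (state l ≟S _)
    ; Final  = λ i → ∃[ l ] Star Silent i l × state l ≡ ([] , nothing)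
    ; final? = λ i → any? λ l → silent*? i l ×-dec (state l ≟S _)
    }
    where
    silent*? : Decidable (Star Silent)
    silent*? = star? λ i j → any? λ B → (state i ≟S ([] , just B)) ×-dec ((B , state j) ∈? rules)

  open NFA nfa using (Accepts; []; _∷_; init)

  accepts-silent : ∀ {i j v} → Silent i j → Accepts j v → Accepts i v
  accepts-silent s ([] (l , p , f))      = [] (l , s ◅ p , f)
  accepts-silent s ((l , p , r) ∷ accs) = (l , s ◅ p , r) ∷ accs

  reads⇒accepts : ∀ {s v} → Reads s v → ∀ i → state i ≡ s → Accepts i v
  reads⇒accepts stop i eq = [] (i , ε , eq)
  reads⇒accepts (call {B} r∈ r) i eq =
    accepts-silent (B , eq , subst (λ s → (B , s) ∈ rules) (lookup-index s∈) r∈)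
                   (reads⇒accepts r (index s∈) (sym (lookup-index s∈)))
    where s∈ = called-state r∈
  reads⇒accepts (read {x} r) i eq =
    (i , ε , trans eq (cong (λ s → x ∷ proj₁ s , proj₂ s) (lookup-index s∈))) ∷
    reads⇒accepts r (index s∈) (sym (lookup-index s∈))
    where s∈ = tail-state (subst (_∈ states) eq (∈-lookup {xs = states} i))

  reads-silent : ∀ {i j v} → Star Silent i j → Reads (state j) v → Reads (state i) v
  reads-silent ε                 r = r
  reads-silent ((B , eq , r∈) ◅ p) r = subst (λ s → Reads s _) (sym eq) (call r∈ (reads-silent p r))

  accepts⇒reads : ∀ {i v} → Accepts i v → Reads (state i) v
  accepts⇒reads ([] (l , p , eq)) = reads-silent p (subst (λ s → Reads s []) (sym eq) stop)
  accepts⇒reads ((l , p , eq) ∷ a) =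
    reads-silent p (subst (λ s → Reads s _) (sym eq) (read (accepts⇒reads a)))

  L-RLG⇒accepts : ∀ {w} → L-RLG H w → Accepts init w
  L-RLG⇒accepts d = reads⇒accepts (derives⇒reads d) zero refl

  accepts⇒L-RLG : ∀ {w} → Accepts init w → L-RLG H w
  accepts⇒L-RLG a with _ , refl , d ← reads⇒denotes (accepts⇒reads a) = d

-- From pair grammars to context-sensitive grammars

module _ (N : Set) (k : ℕ) where

  Word : Set
  Word = List (N ⊎ Fin k)

  ContextRule : Set
  ContextRule = Word × N × Word × Word

module _ {N : Set} {k : ℕ} where

  before after : ContextRule N k → Word N k
  before (α , A , β , γ) = α ++ inj₁ A ∷ β
  after  (α , A , β , γ) = α ++ γ ++ β

  data ContextStep (rules : List (ContextRule N k)) : Word N k → Word N k → Set where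
    apply : ∀ {r} u v → r ∈ rules → ContextStep rules (u ++ before r ++ v) (u ++ after r ++ v)

  ContextLang : List (ContextRule N k) → N → Lang k
  ContextLang rules S z = Star (ContextStep rules) [ inj₁ S ] (map inj₂ z)

  Erasing : N → List (ContextRule N k) → ContextRule N k → Set
  Erasing S rules (α , A , β , γ) =
    (α ≡ [] × A ≡ S × β ≡ []) × (∀ {r} → r ∈ rules → inj₁ S ∉ after r)

-- `decode` is applied letter by letter and undoes `encode` on the rules. It therefore carries
-- derivations back from arbitrary words, without any need to show that sentential forms stay in the
-- image of `encode`.
module Relabel {N : Set} {k : ℕ} (F : Finite N) (S : N) (rules : List (ContextRule N k))
  (wf : ∀ {r} → r ∈ rules → proj₂ (proj₂ (proj₂ r)) ≡ [] → Erasing S rules r) where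
  open Finite F

  encode : Word N k → List (Sym size k)
  encode = map (map₁ enc)

  decode : List (Sym size k) → Word N k
  decode = map (map₁ dec)

  decode-encode : ∀ w → decode (encode w) ≡ w
  decode-encode []           = refl
  decode-encode (inj₁ A ∷ w) = cong₂ _∷_ (cong inj₁ (dec-enc A)) (decode-encode w)
  decode-encode (inj₂ a ∷ w) = cong (inj₂ a ∷_) (decode-encode w)

  encodeRule : ContextRule N k → CSRule size k
  encodeRule (α , A , β , γ) = encode α , enc A , encode β , encode γ

  lhs-encode : ∀ r → lhs (encodeRule r) ≡ encode (before r)
  lhs-encode (α , A , β , γ) = sym (map-++ _ α _)

  rhs-encode : ∀ r → rhs (encodeRule r) ≡ encode (after r)
  rhs-encode (α , A , β , γ) = sym (trans (map-++ _ α _) (cong (_ ++_) (map-++ _ γ β)))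

  ∈-encode⁻ : ∀ w → inj₁ (enc S) ∈ encode w → inj₁ S ∈ w
  ∈-encode⁻ w p = subst₂ _∈_ (cong inj₁ (dec-enc S)) (decode-encode w) (∈-map⁺ (map₁ dec) p)

  encode-[] : ∀ w → encode w ≡ [] → w ≡ []
  encode-[] [] _ = refl

  csg : CSG k
  csg = record
    { nts        = size
    ; start      = enc S
    ; rules      = map encodeRule rules
    ; wellFormed = All.tabulate erasing
    }
    where
    erasing : ∀ {r} → r ∈ map encodeRule rules → proj₂ (proj₂ (proj₂ r)) ≡ [] →
              (proj₁ r ≡ [] × proj₁ (proj₂ r) ≡ enc S × proj₁ (proj₂ (proj₂ r)) ≡ []) ×
              All (λ r′ → inj₁ (enc S) ∉ rhs r′) (map encodeRule rules)
    erasing r∈ γ≡[] with ∈-map⁻ encodeRule r∈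
    ... | (α , A , β , γ) , r∈′ , refl with wf r∈′ (encode-[] γ γ≡[])
    ...   | (refl , refl , refl) , fresh = (refl , refl , refl) , All.tabulate fresh′
      where
      fresh′ : ∀ {r′} → r′ ∈ map encodeRule rules → inj₁ (enc S) ∉ rhs r′
      fresh′ r∈ p with ∈-map⁻ encodeRule r∈
      ... | r , r∈′ , refl = fresh r∈′ (∈-encode⁻ (after r) (subst (_ ∈_) (rhs-encode r) p))

  encode-context : ∀ u w v → encode (u ++ w ++ v) ≡ encode u ++ encode w ++ encode v
  encode-context u w v = trans (map-++ _ u _) (cong (encode u ++_) (map-++ _ w v))

  encode-step : ∀ {x y} → ContextStep rules x y → CSStep csg (encode x) (encode y)
  encode-step (apply {r} u v r∈) =
    subst₂ (CSStep csg)
      (trans (cong (λ w → encode u ++ w ++ encode v) (lhs-encode r)) (sym (encode-context u (before r) v)))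
      (trans (cong (λ w → encode u ++ w ++ encode v) (rhs-encode r)) (sym (encode-context u (after r) v)))
      (apply (encode u) (encode v) (∈-map⁺ encodeRule r∈))

  decode-context : ∀ u w v → decode (u ++ encode w ++ v) ≡ decode u ++ w ++ decode v
  decode-context u w v =
    trans (map-++ _ u _) (cong (decode u ++_) (trans (map-++ _ (encode w) v)
                                                     (cong (_++ decode v) (decode-encode w))))

  decode-step : ∀ {x y} → CSStep csg x y → ContextStep rules (decode x) (decode y)
  decode-step (apply u v r∈) with ∈-map⁻ encodeRule r∈
  ... | r , r∈′ , refl =
    subst₂ (ContextStep rules)
      (sym (trans (cong (λ w → decode (u ++ w ++ v)) (lhs-encode r)) (decode-context u (before r) v)))
      (sym (trans (cong (λ w → decode (u ++ w ++ v)) (rhs-encode r)) (decode-context u (after r) v)))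
      (apply (decode u) (decode v) r∈′)

  encode-terminals : ∀ z → encode (map inj₂ z) ≡ map inj₂ z
  encode-terminals []      = refl
  encode-terminals (a ∷ z) = cong (inj₂ a ∷_) (encode-terminals z)

  decode-terminals : ∀ z → decode (map inj₂ z) ≡ map inj₂ z
  decode-terminals []      = refl
  decode-terminals (a ∷ z) = cong (inj₂ a ∷_) (decode-terminals z)

  relabel : ∀ z → ContextLang rules S z ⇔ L-CSG csg z
  relabel z = mk⇔
    (λ d → subst (Star (CSStep csg) _) (encode-terminals z) (gmap encode encode-step d))
    (λ d → subst₂ (Star (ContextStep rules)) (decode-encode [ inj₁ S ]) (decode-terminals z)
             (gmap decode decode-step d))

-- (A , X , γ) stands for the rule A → Xγ and (A , B , C , X , γ) for AB → CXγ.
record PairGrammar (k : ℕ) : Set₁ where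
  field
    N      : Set
    finite : Finite N
    start  : N
    singles : List (N × (N ⊎ Fin k) × Word N k)
    pairs   : List (N × N × (N ⊎ Fin k) × (N ⊎ Fin k) × Word N k)

  data Step : Word N k → Word N k → Set where
    single : ∀ {A X γ} u v → (A , X , γ) ∈ singles →
             Step (u ++ inj₁ A ∷ v) (u ++ X ∷ γ ++ v)
    pair   : ∀ {A B C X γ} u v → (A , B , C , X , γ) ∈ pairs →
             Step (u ++ inj₁ A ∷ inj₁ B ∷ v) (u ++ C ∷ X ∷ γ ++ v)

  Generates : Lang k
  Generates z = Star Step [ inj₁ start ] (map inj₂ z)

-- The i-th rule AB → CXγ is simulated by AB → ⟨1,i⟩B → ⟨1,i⟩⟨2,i⟩ → C⟨2,i⟩ → CXγ, and a
-- sentential form is read back by counting the rule as applied as soon as ⟨2,i⟩ appears.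
-- The marks may be left standing while their neighbours are rewritten, so ⟨1,i⟩ reads as C
-- exactly when ⟨2,i⟩ follows it, and ⟨2,i⟩ always reads as Xγ.
module ToContextSensitive {k : ℕ} (K : PairGrammar k) {E : Set} (E? : Dec E) where
  open PairGrammar K renaming (start to S)

  Index : Set
  Index = Fin (length pairs)

  leftIn rightIn : Index → N
  leftIn i  = proj₁ (lookup pairs i)
  rightIn i = proj₁ (proj₂ (lookup pairs i))

  leftOut : Index → N ⊎ Fin k
  leftOut i = proj₁ (proj₂ (proj₂ (lookup pairs i)))

  rightOut : Index → Word N k
  rightOut i = let _ , _ , _ , X , γ = lookup pairs i in X ∷ γ

  -- A pair grammar never shortens a word and so cannot produce λ. The fresh `start` makes room for
  -- an erasing rule, present exactly when `E` holds.
  data Node : Set where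
    start  : Node
    plain  : N → Node
    first  : Index → Node
    second : Index → Node

  abstract
    finite-Node : Finite Node
    finite-Node = finite-retract to from retract
                    (finite-⊤ ⊎-finite finite ⊎-finite finite-Fin _ ⊎-finite finite-Fin _)
      where
      to : Node → ⊤ ⊎ N ⊎ Index ⊎ Index
      to start      = inj₁ tt
      to (plain A)  = inj₂ (inj₁ A)
      to (first i)  = inj₂ (inj₂ (inj₁ i))
      to (second i) = inj₂ (inj₂ (inj₂ i))
      from : ⊤ ⊎ N ⊎ Index ⊎ Index → Node
      from (inj₁ _)               = start
      from (inj₂ (inj₁ A))        = plain A
      from (inj₂ (inj₂ (inj₁ i))) = first i
      from (inj₂ (inj₂ (inj₂ i))) = second i
      retract : ∀ x → from (to x) ≡ x
      retract start      = refl
      retract (plain A)  = refl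
      retract (first i)  = refl
      retract (second i) = refl

  sym⁺ : N ⊎ Fin k → Node ⊎ Fin k
  sym⁺ = map₁ plain

  embed : Word N k → Word Node k
  embed = map sym⁺

  singleRule : N × (N ⊎ Fin k) × Word N k → ContextRule Node k
  singleRule (A , X , γ) = [] , plain A , [] , embed (X ∷ γ)

  -- The left context in `writeRight` forces `writeLeft` to come before it. If `second i` could be
  -- replaced while `first i` still stood on its left, `first i` would again be read as A, although
  -- the rule has already been counted as applied.
  claimLeft claimRight writeLeft writeRight : Index → ContextRule Node k
  claimLeft i = [] , plain (leftIn i) , [ inj₁ (plain (rightIn i)) ] , [ inj₁ (first i) ]
  claimRight i = [ inj₁ (first i) ] , plain (rightIn i) , [] , [ inj₁ (second i) ]
  writeLeft i = [] , first i , [ inj₁ (second i) ] , [ sym⁺ (leftOut i) ]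
  writeRight i = [ sym⁺ (leftOut i) ] , second i , [] , embed (rightOut i)

  data Rule : ContextRule Node k → Set where
    erase  : E → Rule ([] , start , [] , [])
    init   : Rule ([] , start , [] , [ inj₁ (plain (S)) ])
    single : ∀ {A X γ} → (A , X , γ) ∈ singles → Rule (singleRule (A , X , γ))
    pair₁  : ∀ i → Rule (claimLeft i)
    pair₂  : ∀ i → Rule (claimRight i)
    pair₃  : ∀ i → Rule (writeLeft i)
    pair₄  : ∀ i → Rule (writeRight i)

  erasingRules : Dec E → List (ContextRule Node k)
  erasingRules (yes _) = [ [] , start , [] , [] ]
  erasingRules (no _)  = []

  simulation : Index → List (ContextRule Node k)
  simulation i = claimLeft i ∷ claimRight i ∷ writeLeft i ∷ writeRight i ∷ []

  singleRules pairRules : List (ContextRule Node k)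
  singleRules = map singleRule singles
  pairRules = concatMap simulation (allFin _)

  rules : List (ContextRule Node k)
  rules = ([] , start , [] , [ inj₁ (plain (S)) ]) ∷ erasingRules E? ++ singleRules ++ pairRules

  ∈-erasing⁺ : ∀ E? → E → ([] , start , [] , []) ∈ erasingRules E?
  ∈-erasing⁺ (yes _) e = here refl
  ∈-erasing⁺ (no ¬e) e = contradiction e ¬e

  ∈-erasing⁻ : ∀ E? {r} → r ∈ erasingRules E? → Rule r
  ∈-erasing⁻ (yes e) (here refl) = erase e

  ∈-pairs⁺ : ∀ i {r} → r ∈ simulation i → r ∈ rules
  ∈-pairs⁺ i p = 
    there (∈-++⁺ʳ (erasingRules E?) (∈-++⁺ʳ singleRules (∈-concatMap⁺ simulation (lose (∈-allFin i) p))))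

  rule⁺ : ∀ {r} → Rule r → r ∈ rules
  rule⁺ (erase e)  = there (∈-++⁺ˡ (∈-erasing⁺ E? e))
  rule⁺ init       = here refl
  rule⁺ (single p) = there (∈-++⁺ʳ (erasingRules E?) (∈-++⁺ˡ (∈-map⁺ singleRule p)))
  rule⁺ (pair₁ i)  = ∈-pairs⁺ i (here refl)
  rule⁺ (pair₂ i)  = ∈-pairs⁺ i (there (here refl))
  rule⁺ (pair₃ i)  = ∈-pairs⁺ i (there (there (here refl)))
  rule⁺ (pair₄ i)  = ∈-pairs⁺ i (there (there (there (here refl))))

  rule⁻ : ∀ {r} → r ∈ rules → Rule r
  rule⁻ (here refl) = init
  rule⁻ (there p) with ∈-++⁻ (erasingRules E?) p
  ... | inj₁ q = ∈-erasing⁻ E? q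
  ... | inj₂ q with ∈-++⁻ singleRules q
  ...   | inj₁ s with ∈-map⁻ singleRule s
  ...     | _ , s∈ , refl = single s∈
  rule⁻ (there p) | inj₂ q | inj₂ s with find (∈-concatMap⁻ simulation {xs = allFin _} s)
  ... | i , _ , here refl                         = pair₁ i
  ... | i , _ , there (here refl)                 = pair₂ i
  ... | i , _ , there (there (here refl))         = pair₃ i
  ... | i , _ , there (there (there (here refl))) = pair₄ i

  start∉embed : ∀ w → inj₁ start ∉ embed w
  start∉embed w p with ∈-map⁻ sym⁺ p
  ... | inj₁ _ , _ , ()
  ... | inj₂ _ , _ , ()

  start-fresh : ∀ {r} → Rule r → inj₁ start ∉ after r
  start-fresh init                         = start∉embed [ inj₁ _ ]
  start-fresh (single {X = X} {γ} _) p     = start∉embed (X ∷ γ) (subst (inj₁ start ∈_) (++-identityʳ _) p)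
  start-fresh (pair₁ i)                    (there p) = start∉embed [ inj₁ _ ] p
  start-fresh (pair₂ i)                    (there (here ()))
  start-fresh (pair₃ i) (here p)           = start∉embed [ leftOut i ] (here p)
  start-fresh (pair₃ i) (there (here ()))
  start-fresh (pair₄ i) (here p)           = start∉embed [ leftOut i ] (here p)
  start-fresh (pair₄ i) (there p)          = start∉embed (rightOut i) (subst (inj₁ start ∈_) (++-identityʳ _) p)

  erasing : ∀ {r} → r ∈ rules → proj₂ (proj₂ (proj₂ r)) ≡ [] → Erasing start rules r
  erasing r∈ eq with rule⁻ r∈
  ... | erase e = (refl , refl , refl) , λ r′∈ → start-fresh (rule⁻ r′∈)

  -- Reading back intermediate sentential forms

  readFirst : Index → Maybe (Node ⊎ Fin k) → N ⊎ Fin k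
  readFirst i (just (inj₁ (second j))) with i Fin.≟ j
  ... | yes _ = leftOut i
  ... | no  _ = inj₁ (leftIn i)
  readFirst i _ = inj₁ (leftIn i)

  readBack : Word Node k → Word N k
  readBack []                  = []
  readBack (inj₂ a ∷ w)        = inj₂ a ∷ readBack w
  readBack (inj₁ start ∷ w)    = inj₁ (S) ∷ readBack w
  readBack (inj₁ (plain A) ∷ w) = inj₁ A ∷ readBack w
  readBack (inj₁ (first i) ∷ w) = readFirst i (List.head w) ∷ readBack w
  readBack (inj₁ (second i) ∷ w) = rightOut i ++ readBack w

  -- These are the symbols other than `second`. Only a `second` can influence how its left neighbour
  -- is read, so reading splits in front of a local symbol. Both sides of every rule, except the one
  -- that erases `start`, begin with such a symbol; hence a step never changes the reading of the
  -- part to its left.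
  data Local : Node ⊎ Fin k → Set where
    terminal : ∀ a → Local (inj₂ a)
    start    : Local (inj₁ start)
    plain    : ∀ A → Local (inj₁ (plain A))
    first    : ∀ i → Local (inj₁ (first i))

  local : ∀ X → Local (sym⁺ X)
  local (inj₁ A) = plain A
  local (inj₂ a) = terminal a

  readFirst-local : ∀ i {x} → Local x → readFirst i (just x) ≡ inj₁ (leftIn i)
  readFirst-local i (terminal a) = refl
  readFirst-local i start        = refl
  readFirst-local i (plain A)    = refl
  readFirst-local i (first j)    = refl

  readBack-++ : ∀ u {x w} → Local x → readBack (u ++ x ∷ w) ≡ readBack u ++ readBack (x ∷ w)
  readBack-++ []                   l = refl
  readBack-++ (inj₂ a ∷ u)         l = cong (_ ∷_) (readBack-++ u l)
  readBack-++ (inj₁ start ∷ u)     l = cong (_ ∷_) (readBack-++ u l)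
  readBack-++ (inj₁ (plain A) ∷ u) l = cong (_ ∷_) (readBack-++ u l)
  readBack-++ (inj₁ (first i) ∷ []) l = cong (_∷ _) (readFirst-local i l)
  readBack-++ (inj₁ (first i) ∷ y ∷ u) l = cong (_ ∷_) (readBack-++ (y ∷ u) l)
  readBack-++ (inj₁ (second i) ∷ u) l =
    trans (cong (rightOut i ++_) (readBack-++ u l)) (sym (++-assoc (rightOut i) _ _))

  readBack-sym : ∀ X w → readBack (sym⁺ X ∷ w) ≡ X ∷ readBack w
  readBack-sym (inj₁ A) w = refl
  readBack-sym (inj₂ a) w = refl

  readBack-embed : ∀ γ w → readBack (embed γ ++ w) ≡ γ ++ readBack w
  readBack-embed []      w = refl
  readBack-embed (X ∷ γ) w = trans (readBack-sym X _) (cong (X ∷_) (readBack-embed γ w))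

  readFirst-second : ∀ i → readFirst i (just (inj₁ (second i))) ≡ leftOut i
  readFirst-second i with i Fin.≟ i
  ... | yes _  = refl
  ... | no i≢i = contradiction refl i≢i

  _⇒*_ : Word N k → Word N k → Set
  _⇒*_ = Star Step

  ≡⇒* : ∀ {v w} → v ≡ w → v ⇒* w
  ≡⇒* refl = ε

  -- The invariant of derivations. Since `start` never returns after the first step, the erasing
  -- rule cannot delete anything inside a longer word.
  data Reachable (w : Word Node k) : Set where
    initial : w ≡ [ inj₁ start ] → Reachable w
    erased  : w ≡ [] → E → Reachable w
    derived : inj₁ start ∉ w → [ inj₁ (S) ] ⇒* readBack w → Reachable w

  after-∉ : ∀ u v {r} → Rule r → inj₁ start ∉ u ++ before r ++ v → inj₁ start ∉ u ++ after r ++ v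
  after-∉ u v {r} rule ∉w p with ∈-++⁻ u p
  ... | inj₁ q = ∉w (∈-++⁺ˡ q)
  ... | inj₂ q with ∈-++⁻ (after r) q
  ...   | inj₁ s = start-fresh rule s
  ...   | inj₂ s = ∉w (∈-++⁺ʳ u (∈-++⁺ʳ (before r) s))

  readBack-step : ∀ u v {r} → Rule r → inj₁ start ∉ u ++ before r ++ v →
                  readBack (u ++ before r ++ v) ⇒* readBack (u ++ after r ++ v)
  readBack-step u v (erase e) ∉w = ⊥-elim (∉w (∈-++⁺ʳ u (here refl)))
  readBack-step u v init ∉w      = ⊥-elim (∉w (∈-++⁺ʳ u (here refl)))
  readBack-step u v (single {A} {X} {γ} p) _ = subst₂ _⇒*_
    (sym (readBack-++ u (plain A)))
    (sym (trans (readBack-++ u (local X)) (cong (readBack u ++_)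
      (trans (cong (λ w → readBack (w ++ v)) (++-identityʳ (embed (X ∷ γ)))) (readBack-embed (X ∷ γ) v)))))
    (single (readBack u) (readBack v) p ◅ ε)
  readBack-step u v (pair₁ i) _ = ≡⇒* (trans (readBack-++ u (plain _)) (sym (readBack-++ u (first i))))
  readBack-step u v (pair₂ i) _ = subst₂ _⇒*_
    (sym (readBack-++ u (first i)))
    (sym (trans (readBack-++ u (first i))
      (cong (λ X → readBack u ++ X ∷ rightOut i ++ readBack v) (readFirst-second i))))
    (pair (readBack u) (readBack v) (∈-lookup i) ◅ ε)
  readBack-step u v (pair₃ i) _ = ≡⇒* (trans (readBack-++ u (first i)) (trans
    (cong (λ X → readBack u ++ X ∷ rightOut i ++ readBack v) (readFirst-second i))
    (sym (trans (readBack-++ u (local (leftOut i))) (cong (readBack u ++_) (readBack-sym (leftOut i) _))))))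
  readBack-step u v (pair₄ i) _ = ≡⇒* (trans (readBack-++ u (local (leftOut i))) (trans
    (cong (readBack u ++_) (trans (readBack-sym (leftOut i) _) (trans
      (cong (leftOut i ∷_) (sym (trans (cong (λ w → readBack (w ++ v)) (++-identityʳ (embed (rightOut i))))
                                       (readBack-embed (rightOut i) v))))
      (sym (readBack-sym (leftOut i) _)))))
    (sym (readBack-++ u (local (leftOut i))))))

  reachable-step : ∀ {w w′} → ContextStep rules w w′ → Reachable w → Reachable w′
  reachable-step (apply u v r∈) (initial eq) with rule⁻ r∈
  ... | erase e with refl , _ , refl ← singleton-middle u eq = erased refl e
  ... | init with refl , _ , refl ← singleton-middle u eq = derived (start∉embed [ inj₁ _ ]) ε
  ... | single _ with _ , () , _ ← singleton-middle u eq
  ... | pair₁ _ with _ , () , _ ← singleton-middle u eq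
  ... | pair₂ _ with _ , () , _ ← singleton-middle u eq
  ... | pair₃ _ with _ , () , _ ← singleton-middle u eq
  ... | pair₄ i with _ , _ , () ← singleton-middle u eq
  reachable-step (apply {α , _} u v r∈) (erased eq e)
    with () ← ++-conicalʳ α _ (++-conicalˡ _ v (++-conicalʳ u _ eq))
  reachable-step (apply u v r∈) (derived ∉w d) =
    derived (after-∉ u v (rule⁻ r∈) ∉w) (d ◅◅ readBack-step u v (rule⁻ r∈) ∉w)

  reachable : ∀ {w w′} → Star (ContextStep rules) w w′ → Reachable w → Reachable w′
  reachable ε       g = g
  reachable (s ◅ d) g = reachable d (reachable-step s g)

  embed-terminals : ∀ z → embed (map inj₂ z) ≡ map inj₂ z
  embed-terminals []      = refl
  embed-terminals (a ∷ z) = cong (_ ∷_) (embed-terminals z)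

  readBack-terminals : ∀ z → readBack (map inj₂ z) ≡ map inj₂ z
  readBack-terminals []      = refl
  readBack-terminals (a ∷ z) = cong (_ ∷_) (readBack-terminals z)

  Target : Lang k
  Target z = (z ≡ [] × E) ⊎ Generates z

  sound : ∀ z → ContextLang rules start z → Target z
  sound z d with reachable d (initial refl)
  sound []      d | initial ()
  sound (_ ∷ _) d | initial ()
  sound []      d | erased eq e = inj₁ (refl , e)
  sound z       d | derived _ d′ = inj₂ (d′ ◅◅ ≡⇒* (readBack-terminals z))

  -- Simulating a pair grammar by context-sensitive rules

  context-step : ∀ u v {r} → Rule r → ContextStep rules (u ++ before r ++ v) (u ++ after r ++ v)
  context-step u v rule = apply u v (rule⁺ rule)

  embed-step : ∀ {w w′} → Step w w′ → Star (ContextStep rules) (embed w) (embed w′)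
  embed-step (single {A} {X} {γ} u v p) = subst₂ (ContextStep rules)
    (sym (map-++ sym⁺ u (inj₁ A ∷ v)))
    (trans (cong (λ w → embed u ++ w ++ embed v) (++-identityʳ (embed (X ∷ γ))))
           (sym (trans (map-++ sym⁺ u _) (cong (embed u ++_) (map-++ sym⁺ (X ∷ γ) v)))))
    (context-step (embed u) (embed v) (single p)) ◅ ε
  embed-step (pair u v p) with index p | lookup-index p
  ... | i | refl = subst₂ (Star (ContextStep rules))
    (sym (map-++ sym⁺ u (inj₁ (leftIn i) ∷ inj₁ (rightIn i) ∷ v)))
    (trans (cong (λ w → embed u ++ sym⁺ (leftOut i) ∷ w ++ embed v) (++-identityʳ (embed (rightOut i))))
           (sym (trans (map-++ sym⁺ u _)
      (cong (λ w → embed u ++ sym⁺ (leftOut i) ∷ w) (map-++ sym⁺ (rightOut i) v)))))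
    (context-step (embed u) (embed v) (pair₁ i) ◅ context-step (embed u) (embed v) (pair₂ i) ◅
     context-step (embed u) (embed v) (pair₃ i) ◅ context-step (embed u) (embed v) (pair₄ i) ◅ ε)

  embed-steps : ∀ {w w′} → Star Step w w′ → Star (ContextStep rules) (embed w) (embed w′)
  embed-steps ε       = ε
  embed-steps (s ◅ d) = embed-step s ◅◅ embed-steps d

  complete : ∀ z → Target z → ContextLang rules start z
  complete z (inj₁ (refl , e)) = context-step [] [] (erase e) ◅ ε
  complete z (inj₂ d) = context-step [] [] init ◅
    subst (Star (ContextStep rules) _) (embed-terminals z) (embed-steps d)

  context-sensitive : InCS Target
  context-sensitive = csg , λ z → mk⇔
    (λ t → Equivalence.to (relabel z) (complete z t))
    (λ d → sound z (Equivalence.from (relabel z) d))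
    where open Relabel finite-Node start rules erasing

-- Sweeping over levels

module _ {I B : Set} (F : Finite I) {P : I → Set} (P? : Decidable₁ P) (f : I → B) where

  abstract
   collect : List B
   collect = map f (filter P? (Finite.elements F))

   ∈-collect⁺ : ∀ {i} → P i → f i ∈ collect
   ∈-collect⁺ p = ∈-map⁺ f (∈-filter⁺ P? (Finite.∈-elements F _) p)

   ∈-collect⁻ : ∀ {y} → y ∈ collect → ∃[ i ] P i × y ≡ f i
   ∈-collect⁻ y∈ with ∈-map⁻ f y∈
   ... | i , i∈ , eq = i , proj₂ (∈-filter⁻ P? {xs = Finite.elements F} i∈) , eq

-- This locates the head: a tape has just one headed cell, so a rule whose left-hand side contains a
-- headed cell can match only there.
unique-middle : ∀ {A : Set} (p : A → Bool) {a h} u {v} U {V} →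
                All (λ x → p x ≡ false) U → All (λ x → p x ≡ false) V → p a ≡ true →
                u ++ a ∷ v ≡ U ++ h ∷ V → u ≡ U × a ≡ h × v ≡ V
unique-middle p []      []      pU pV pa refl = refl , refl , refl
unique-middle p []      (x ∷ U) (px ∷ pU) pV pa eq with refl , _ ← ∷-injective eq
  with () ← trans (sym pa) px
unique-middle p (x ∷ u) []      pU pV pa eq with _ , refl ← ∷-injective eq
  with () ← trans (sym pa) (All.lookup pV (∈-++⁺ʳ u (here refl)))
unique-middle p (x ∷ u) (y ∷ U) (_ ∷ pU) pV pa eq with refl , eq′ ← ∷-injective eq
  with refl , refl , refl ← unique-middle p u U pU pV pa eq′ = refl , refl , refl

null-++ : ∀ {A : Set} (u v : List A) → null (u ++ v) ≡ null v ∧ null u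
null-++ []      v = sym (∧-identityʳ (null v))
null-++ (x ∷ u) v with null v
... | true  = refl
... | false = refl

null-true : ∀ {A : Set} (u : List A) → true ≡ null u → u ≡ []
null-true [] _ = refl

-- One level of a derivation tree is processed in two sweeps of a single head: from left to
-- right the control automaton reads the live items, from right to left every item is expanded.
-- A last sweep from left to right turns the items into terminals.
module Machine {m k : ℕ} (P : Prods m k) (nonEmpty : ∀ {A} → (A , []) ∉ P)
               (S : Fin m) (M : NFA (Sym m k)) where
  open NFA M

  data Head : Set where
    none : Head
    scan : Fin size → Head
    back : Head
    emit : Head

  -- The two flags mark the leftmost and the rightmost cell.
  data Cell : Set where
    cell : Bool → Bool → Item m k → Head → Cell

  abstract
    finite-Item : Finite (Item m k)
    finite-Item = finite-retract to from retract ((finite-Fin m ⊎-finite finite-Fin k) ⊎-finite finite-Fin k)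
      where
      to : Item m k → Sym m k ⊎ Fin k
      to (live x) = inj₁ x
      to (done a) = inj₂ a
      from : Sym m k ⊎ Fin k → Item m k
      from (inj₁ x) = live x
      from (inj₂ a) = done a
      retract : ∀ x → from (to x) ≡ x
      retract (live x) = refl
      retract (done a) = refl

    finite-Head : Finite Head
    finite-Head = finite-retract to from retract
      (finite-⊤ ⊎-finite finite-Fin size ⊎-finite finite-⊤ ⊎-finite finite-⊤)
      where
      to : Head → ⊤ ⊎ Fin size ⊎ ⊤ ⊎ ⊤
      to none     = inj₁ tt
      to (scan q) = inj₂ (inj₁ q)
      to back     = inj₂ (inj₂ (inj₁ tt))
      to emit     = inj₂ (inj₂ (inj₂ tt))
      from : ⊤ ⊎ Fin size ⊎ ⊤ ⊎ ⊤ → Head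
      from (inj₁ _)               = none
      from (inj₂ (inj₁ q))        = scan q
      from (inj₂ (inj₂ (inj₁ _))) = back
      from (inj₂ (inj₂ (inj₂ _))) = emit
      retract : ∀ x → from (to x) ≡ x
      retract none     = refl
      retract (scan q) = refl
      retract back     = refl
      retract emit     = refl

    finite-Cell : Finite Cell
    finite-Cell = finite-retract (λ { (cell l r x h) → l , r , x , h })
      (λ (l , r , x , h) → cell l r x h) (λ { (cell l r x h) → refl })
      (finite-Bool ×-finite finite-Bool ×-finite finite-Item ×-finite finite-Head)

  Tape : Set
  Tape = Word Cell k

  cell-injective : ∀ {l r x h l′ r′ x′ h′} → inj₁ {B = Fin k} (cell l r x h) ≡ inj₁ (cell l′ r′ x′ h′) →
                   l ≡ l′ × r ≡ r′ × x ≡ x′ × h ≡ h′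
  cell-injective refl = refl , refl , refl , refl

  -- The flag tells whether the right end of the tape follows this segment directly. It is needed
  -- because the cells that replace a rightmost cell pass its end marker on to the last of them.
  tailCells : Bool → List (Item m k) → Tape
  tailCells r []      = []
  tailCells r (x ∷ c) = inj₁ (cell false (r ∧ null c) x none) ∷ tailCells r c

  rights : List (Item m k) → Tape
  rights = tailCells true

  lefts : List (Item m k) → Tape
  lefts []      = []
  lefts (x ∷ c) = inj₁ (cell true false x none) ∷ map (λ y → inj₁ (cell false false y none)) c

  tape : List (Item m k) → Item m k → Head → List (Item m k) → Tape
  tape u x h v = lefts u ++ inj₁ (cell (null u) (null v) x h) ∷ rights v

  data Read : Fin size → Item m k → Fin size → Set where
    live : ∀ {q x q′} → Trans q x q′ → Read q (live x) q′
    done : ∀ {q a} → Read q (done a) q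

  -- At the left end the machine guesses whether the new level is the last. With `emit` the new
  -- level is not read by the automaton, in keeping with the exemption of the last level; a wrong
  -- guess leaves the head stuck in front of a nonterminal.
  data Restart : Head → Set where
    again : Restart (scan init)
    last  : Restart emit

  data Single : Cell × (Cell ⊎ Fin k) × Tape → Set where
    turn    : ∀ l {x q q′} → Read q x q′ → Final q′ →
              Single (cell l true x (scan q) , inj₁ (cell l true x back) , [])
    restart : ∀ r {x y γ h} → Expand P x (y ∷ γ) → Restart h →
              Single (cell true r x back , inj₁ (cell true (r ∧ null γ) y h) , tailCells r γ)
    finish  : ∀ l {x a} → Terminal x a → Single (cell l true x emit , inj₂ a , [])

  data Pair : Cell × Cell × (Cell ⊎ Fin k) × (Cell ⊎ Fin k) × Tape → Set where
    scan : ∀ l r y {x q q′} → Read q x q′ →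
           Pair (cell l false x (scan q) , cell false r y none ,
                 inj₁ (cell l false x none) , inj₁ (cell false r y (scan q′)) , [])
    back : ∀ l r y {x x′ γ} → Expand P x (x′ ∷ γ) →
           Pair (cell l false y none , cell false r x back ,
                 inj₁ (cell l false y back) , inj₁ (cell false (r ∧ null γ) x′ none) , tailCells r γ)
    emit : ∀ l r y {x a} → Terminal x a →
           Pair (cell l false x emit , cell false r y none , inj₂ a , inj₁ (cell false r y emit) , [])

  -- Finite lists of the rules of the machine

  read? : ∀ q x q′ → Dec (Read q x q′)
  read? q (live x) q′ = map′ live (λ { (live t) → t }) (trans? q x q′)
  read? q (done a) q′ = map′ (λ { refl → done }) (λ { done → refl }) (q Fin.≟ q′)

  terminal? : ∀ (x : Item m k) a → Dec (Terminal x a)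
  terminal? (live (inj₁ A)) a = no λ ()
  terminal? (live (inj₂ b)) a = map′ (λ { refl → live }) (λ { live → refl }) (b Fin.≟ a)
  terminal? (done b)        a = map′ (λ { refl → done }) (λ { done → refl }) (b Fin.≟ a)

  -- The result of an expansion is split into first item and rest: the first reuses the old cell,
  -- the rest become new cells. This is where erasing rules have to be absent.
  Expansion : Set
  Expansion = Item m k × Item m k × List (Item m k)

  prodExpansion : Fin m × List (Sym m k) → List Expansion
  prodExpansion (A , [])    = []
  prodExpansion (A , X ∷ γ) = [ live (inj₁ A) , live X , map live γ ]

  doneExpansion termExpansion : Fin k → Expansion
  doneExpansion a = done a , done a , []
  termExpansion a = live (inj₂ a) , done a , []

  dones terms prods expansions : List Expansion
  dones = map doneExpansion (allFin k)
  terms = map termExpansion (allFin k)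
  prods = concatMap prodExpansion P
  expansions = dones ++ terms ++ prods

  ∈-expansions⁺ : ∀ {x y γ} → Expand P x (y ∷ γ) → (x , y , γ) ∈ expansions
  ∈-expansions⁺ e = by-cases e refl
    where
    by-cases : ∀ {x y γ δ} → Expand P x δ → δ ≡ y ∷ γ → (x , y , γ) ∈ expansions
    by-cases done refl = ∈-++⁺ˡ (∈-map⁺ doneExpansion (∈-allFin _))
    by-cases term refl = ∈-++⁺ʳ dones (∈-++⁺ˡ (∈-map⁺ termExpansion (∈-allFin _)))
    by-cases (prod {γ = X ∷ γ} p) refl =
      ∈-++⁺ʳ dones (∈-++⁺ʳ terms (∈-concatMap⁺ prodExpansion (lose p (here refl))))

  ∈-expansions⁻ : ∀ {x y γ} → (x , y , γ) ∈ expansions → Expand P x (y ∷ γ)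
  ∈-expansions⁻ p with ∈-++⁻ dones p
  ... | inj₁ q with _ , _ , refl ← ∈-map⁻ doneExpansion q = done
  ... | inj₂ q with ∈-++⁻ terms q
  ...   | inj₁ s with _ , _ , refl ← ∈-map⁻ termExpansion s = term
  ...   | inj₂ s with find (∈-concatMap⁻ prodExpansion {xs = P} s)
  ...     | (A , X ∷ γ) , r∈ , here refl = prod r∈

  SingleRule PairRule : Set
  SingleRule = Cell × (Cell ⊎ Fin k) × Tape
  PairRule   = Cell × Cell × (Cell ⊎ Fin k) × (Cell ⊎ Fin k) × Tape

  finite-Expansion : Finite (Fin (length expansions))
  finite-Expansion = finite-Fin _

  turnRule : Bool × Item m k × Fin size → SingleRule
  turnRule (l , x , q) = cell l true x (scan q) , inj₁ (cell l true x back) , []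

  CanTurn : Bool × Item m k × Fin size → Set
  CanTurn (l , x , q) = ∃[ q′ ] Read q x q′ × Final q′

  canTurn? : Decidable₁ CanTurn
  canTurn? (l , x , q) = any? λ q′ → read? q x q′ ×-dec final? q′

  restartWith : Head → Bool → Expansion → SingleRule
  restartWith h r (x , y , γ) =
    cell true r x back , inj₁ (cell true (r ∧ null γ) y h) , tailCells r γ

  restartRule : Head → Bool × Fin (length expansions) → SingleRule
  restartRule h (r , e) = restartWith h r (lookup expansions e)

  finishRule : Bool × Item m k × Fin k → SingleRule
  finishRule (l , x , a) = cell l true x emit , inj₂ a , []

  abstract
    finite-turn : Finite (Bool × Item m k × Fin size)
    finite-turn = finite-Bool ×-finite finite-Item ×-finite finite-Fin size

    finite-finish : Finite (Bool × Item m k × Fin k)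
    finite-finish = finite-Bool ×-finite finite-Item ×-finite finite-Fin k

  canFinish? : Decidable₁ λ ((l , x , a) : Bool × Item m k × Fin k) → Terminal x a
  canFinish? (l , x , a) = terminal? x a

  turns finishes singles : List SingleRule
  turns      = collect finite-turn canTurn? turnRule
  finishes   = collect finite-finish canFinish? finishRule

  restarts : Head → List SingleRule
  restarts h = map (restartRule h) (Finite.elements (finite-Bool ×-finite finite-Expansion))

  singles    = turns ++ restarts (scan init) ++ restarts emit ++ finishes

  restarts⁺ : ∀ h r {x y γ} → Expand P x (y ∷ γ) → restartWith h r (x , y , γ) ∈ restarts h
  restarts⁺ h r e = subst (λ e → restartWith h r e ∈ restarts h) (sym (lookup-index e∈))
    (∈-map⁺ (restartRule h) (Finite.∈-elements (finite-Bool ×-finite finite-Expansion) (r , index e∈)))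
    where e∈ = ∈-expansions⁺ e

  expansion : ∀ e → let x , y , γ = lookup expansions e in Expand P x (y ∷ γ)
  expansion e = ∈-expansions⁻ (∈-lookup e)

  restarts⁻ : ∀ {h s} → Restart h → s ∈ restarts h → Single s
  restarts⁻ {h} again? s∈ with (r , e) , _ , refl ← ∈-map⁻ (restartRule h) s∈ =
    restart r (expansion e) again?

  singles⁺ : ∀ {s} → Single s → s ∈ singles
  singles⁺ (turn l r f)        = ∈-++⁺ˡ
    (∈-collect⁺ finite-turn canTurn? turnRule (_ , r , f))
  singles⁺ (restart r e again) = ∈-++⁺ʳ turns (∈-++⁺ˡ (restarts⁺ (scan init) r e))
  singles⁺ (restart r e last)  = ∈-++⁺ʳ turns (∈-++⁺ʳ (restarts (scan init)) (∈-++⁺ˡ (restarts⁺ emit r e)))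
  singles⁺ (finish l t)        = ∈-++⁺ʳ turns (∈-++⁺ʳ (restarts (scan init)) (∈-++⁺ʳ (restarts emit)
    (∈-collect⁺ finite-finish canFinish? finishRule t)))

  singles⁻ : ∀ {s} → s ∈ singles → Single s
  singles⁻ p with ∈-++⁻ turns p
  ... | inj₁ q with (l , x , _) , (_ , r , f) , refl ← ∈-collect⁻ finite-turn canTurn? turnRule q = turn l r f
  ... | inj₂ q with ∈-++⁻ (restarts (scan init)) q
  ...   | inj₁ s = restarts⁻ again s
  ...   | inj₂ s with ∈-++⁻ (restarts emit) s
  ...     | inj₁ t = restarts⁻ last t
  ...     | inj₂ t with (l , _) , t , refl ← ∈-collect⁻ finite-finish canFinish? finishRule t = finish l t

  scanRule : Bool × Bool × Item m k × Item m k × Fin size × Fin size → PairRule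
  scanRule (l , r , y , x , q , q′) =
    cell l false x (scan q) , cell false r y none ,
    inj₁ (cell l false x none) , inj₁ (cell false r y (scan q′)) , []

  backWith : Bool → Bool → Item m k → Expansion → PairRule
  backWith l r y (x , x′ , γ) =
    cell l false y none , cell false r x back ,
    inj₁ (cell l false y back) , inj₁ (cell false (r ∧ null γ) x′ none) , tailCells r γ

  backRule : Bool × Bool × Item m k × Fin (length expansions) → PairRule
  backRule (l , r , y , e) = backWith l r y (lookup expansions e)

  emitRule : Bool × Bool × Item m k × Item m k × Fin k → PairRule
  emitRule (l , r , y , x , a) =
    cell l false x emit , cell false r y none , inj₂ a , inj₁ (cell false r y emit) , []

  abstract
    finite-scan : Finite (Bool × Bool × Item m k × Item m k × Fin size × Fin size)
    finite-scan = finite-Bool ×-finite finite-Bool ×-finite finite-Item ×-finite finite-Item ×-finite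
                  finite-Fin size ×-finite finite-Fin size

    finite-back : Finite (Bool × Bool × Item m k × Fin (length expansions))
    finite-back = finite-Bool ×-finite finite-Bool ×-finite finite-Item ×-finite finite-Expansion

    finite-emit : Finite (Bool × Bool × Item m k × Item m k × Fin k)
    finite-emit = finite-Bool ×-finite finite-Bool ×-finite finite-Item ×-finite finite-Item ×-finite
                  finite-Fin k

  canScan? : Decidable₁ λ ((l , r , y , x , q , q′) :
               Bool × Bool × Item m k × Item m k × Fin size × Fin size) → Read q x q′
  canScan? (_ , _ , _ , x , q , q′) = read? q x q′

  canEmit? : Decidable₁ λ ((l , r , y , x , a) : Bool × Bool × Item m k × Item m k × Fin k) → Terminal x a
  canEmit? (_ , _ , _ , x , a) = terminal? x a

  scans backs emits pairs : List PairRule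
  scans = collect finite-scan canScan? scanRule
  backs = map backRule (Finite.elements finite-back)
  emits = collect finite-emit canEmit? emitRule
  pairs = scans ++ backs ++ emits

  pairs⁺ : ∀ {s} → Pair s → s ∈ pairs
  pairs⁺ (scan l r y t) = ∈-++⁺ˡ (∈-collect⁺ finite-scan canScan? scanRule t)
  pairs⁺ (back l r y e) = ∈-++⁺ʳ scans (∈-++⁺ˡ
    (subst (λ e → backWith l r y e ∈ backs) (sym (lookup-index e∈))
      (∈-map⁺ backRule (Finite.∈-elements finite-back (l , r , y , index e∈)))))
    where e∈ = ∈-expansions⁺ e
  pairs⁺ (emit l r y t) = ∈-++⁺ʳ scans (∈-++⁺ʳ backs (∈-collect⁺ finite-emit canEmit? emitRule t))

  pairs⁻ : ∀ {s} → s ∈ pairs → Pair s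
  pairs⁻ p with ∈-++⁻ scans p
  ... | inj₁ q with (l , r , y , _) , t , refl ← ∈-collect⁻ finite-scan canScan? scanRule q = scan l r y t
  ... | inj₂ q with ∈-++⁻ backs q
  ...   | inj₁ s with (l , r , y , e) , _ , refl ← ∈-map⁻ backRule s = back l r y (expansion e)
  ...   | inj₂ s with (l , r , y , _) , t , refl ← ∈-collect⁻ finite-emit canEmit? emitRule s = emit l r y t

  grammar : PairGrammar k
  grammar = record
    { N = Cell ; finite = finite-Cell ; start = cell true true (live (inj₁ S)) (scan init)
    ; singles = singles ; pairs = pairs }

  open PairGrammar grammar using (Step; Generates; single; pair)

  -- Possible successors of a tape

  headed : Cell ⊎ Fin k → Bool
  headed (inj₁ (cell _ _ _ none))     = false
  headed (inj₁ (cell _ _ _ (scan _))) = true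
  headed (inj₁ (cell _ _ _ back))     = true
  headed (inj₁ (cell _ _ _ emit))     = true
  headed (inj₂ _)                     = false

  Unheaded : Tape → Set
  Unheaded = All (λ s → headed s ≡ false)

  unheaded-tail : ∀ r c → Unheaded (tailCells r c)
  unheaded-tail r []      = []
  unheaded-tail r (x ∷ c) = refl ∷ unheaded-tail r c

  unheaded-lefts : ∀ c → Unheaded (lefts c)
  unheaded-lefts []      = []
  unheaded-lefts (x ∷ c) = refl ∷ All.map⁺ (All.universal (λ _ → refl) c)

  -- The part `U` left of the head is kept general, because it consists of cells during the first
  -- two kinds of sweep and of terminals during the last.
  data Next (U : Tape) (l : Bool) (x : Item m k) : Head → List (Item m k) → Tape → Set where
    scan    : ∀ {q q′ y v} → Read q x q′ →
              Next U l x (scan q) (y ∷ v)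
                (U ++ inj₁ (cell l false x none) ∷ inj₁ (cell false (null v) y (scan q′)) ∷ rights v)
    turn    : ∀ {q q′} → Read q x q′ → Final q′ →
              Next U l x (scan q) [] (U ++ inj₁ (cell l true x back) ∷ [])
    back    : ∀ {U′ l′ y x′ γ v} → U ≡ U′ ∷ʳ inj₁ (cell l′ false y none) → Expand P x (x′ ∷ γ) →
              Next U l x back v (U′ ++ inj₁ (cell l′ false y back) ∷ tailCells (null v) (x′ ∷ γ) ++ rights v)
    restart : ∀ {y γ h v} → true ≡ l → Expand P x (y ∷ γ) → Restart h →
              Next U l x back v (U ++ inj₁ (cell true (null v ∧ null γ) y h) ∷ tailCells (null v) γ ++ rights v)
    emit    : ∀ {a y v} → Terminal x a →
              Next U l x emit (y ∷ v) (U ++ inj₂ a ∷ inj₁ (cell false (null v) y emit) ∷ rights v)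
    finish  : ∀ {a} → Terminal x a → Next U l x emit [] (U ++ inj₂ a ∷ [])

  invert : ∀ {U l x h v s s′} → Unheaded U → Step s s′ → s ≡ U ++ inj₁ (cell l (null v) x h) ∷ rights v →
           Next U l x h v s′
  invert {U} {v = v} pU (single u₀ v₀ p) eq with singles⁻ p
  ... | turn l r f with refl , eq₁ , refl ← unique-middle headed u₀ U pU (unheaded-tail true v) refl eq
    with refl , e , refl , refl ← cell-injective eq₁
    with refl ← null-true v e = turn r f
  ... | restart r e h with refl , eq₁ , refl ← unique-middle headed u₀ U pU (unheaded-tail true v) refl eq
    with l , refl , refl , refl ← cell-injective eq₁ = restart l e h
  ... | finish l t with refl , eq₁ , refl ← unique-middle headed u₀ U pU (unheaded-tail true v) refl eq
    with refl , e , refl , refl ← cell-injective eq₁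
    with refl ← null-true v e = finish t
  invert {U} {v = v} pU (pair u₀ v₀ p) eq with pairs⁻ p
  ... | scan l r y t with refl , eq₁ , eq₂ ← unique-middle headed u₀ U pU (unheaded-tail true v) refl eq
    with refl , e , refl , refl ← cell-injective eq₁
    with y ∷ v′ ← v
    with eq₃ , refl ← ∷-injective eq₂
    with _ , refl , refl , _ ← cell-injective eq₃ = scan t
  ... | emit l r y t with refl , eq₁ , eq₂ ← unique-middle headed u₀ U pU (unheaded-tail true v) refl eq
    with refl , e , refl , refl ← cell-injective eq₁
    with y ∷ v′ ← v
    with eq₃ , refl ← ∷-injective eq₂
    with _ , refl , refl , _ ← cell-injective eq₃ = emit t
  ... | back l r y e
    -- In this rule the head sits on the second cell of the pair, so the first cell belongs to the
    -- part left of the head.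
    with refl , eq₁ , refl ← unique-middle headed (u₀ ∷ʳ _) U pU (unheaded-tail true v) refl
                               (trans (++-assoc u₀ _ _) eq)
    with refl , refl , refl , refl ← cell-injective eq₁ = back refl e

  null-∷ʳ : ∀ (u : List (Item m k)) {x} → null (u ∷ʳ x) ≡ false
  null-∷ʳ []      = refl
  null-∷ʳ (_ ∷ _) = refl

  lefts-∷ʳ : ∀ u x → lefts (u ∷ʳ x) ≡ lefts u ∷ʳ inj₁ (cell (null u) false x none)
  lefts-∷ʳ []      x = refl
  lefts-∷ʳ (y ∷ u) x = cong (_ ∷_) (map-++ _ u [ x ])

  tape-∷ʳ : ∀ u x y h v → tape (u ∷ʳ x) y h v ≡
            lefts u ++ inj₁ (cell (null u) false x none) ∷ inj₁ (cell false (null v) y h) ∷ rights v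
  tape-∷ʳ u x y h v rewrite null-∷ʳ u {x} | lefts-∷ʳ u x = ++-assoc (lefts u) _ _

  tailCells-++ : ∀ r γ v → tailCells r (γ ++ v) ≡ tailCells (r ∧ null v) γ ++ tailCells r v
  tailCells-++ r []      v = refl
  tailCells-++ r (x ∷ γ) v = cong₂ _∷_
    (cong (λ b → inj₁ (cell false b x none))
      (trans (cong (r ∧_) (null-++ γ v)) (sym (∧-assoc r (null v) (null γ)))))
    (tailCells-++ r γ v)

  tape-back : ∀ u y γ v → lefts u ++ inj₁ (cell (null u) false y back) ∷ tailCells (null v) γ ++ rights v ≡
              lefts u ++ inj₁ (cell (null u) false y back) ∷ rights (γ ++ v)
  tape-back u y γ v =
    cong (λ t → lefts u ++ inj₁ (cell (null u) false y back) ∷ t) (sym (tailCells-++ true γ v))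

  tape-restart : ∀ y h γ v → inj₁ (cell true (null v ∧ null γ) y h) ∷ tailCells (null v) γ ++ rights v ≡
                 tape [] y h (γ ++ v)
  tape-restart y h γ v = sym
    (cong₂ _∷_ (cong (λ b → inj₁ (cell true b y h)) (null-++ γ v)) (tailCells-++ true γ v))

  not-terminal : ∀ (U : Tape) {C V} z → U ++ inj₁ C ∷ V ≢ map inj₂ z
  not-terminal []      []      ()
  not-terminal []      (_ ∷ _) ()
  not-terminal (_ ∷ U) (_ ∷ z) eq = not-terminal U z (proj₂ (∷-injective eq))

  -- From machine derivations to runs

  MachineRun : List (Item m k) → List (Fin k) → Set
  MachineRun = Run P (Accepts init)

  accepts-read : ∀ {q x q′ c} → Read q x q′ → Accepts q′ (lives c) → Accepts q (lives (x ∷ c))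
  accepts-read (live t) a = t ∷ a
  accepts-read done     a = a

  accepts-read⁻ : ∀ {q} x c → Accepts q (lives (x ∷ c)) → ∃[ q′ ] Read q x q′ × Accepts q′ (lives c)
  accepts-read⁻ (live x) c (t ∷ a) = _ , live t , a
  accepts-read⁻ (done a) c acc     = _ , done , acc

  Derives : Tape → List (Fin k) → Set
  Derives s z = Star Step s (map inj₂ z)

  emit-sound : ∀ {s t} → Star Step s t → ∀ {z} → t ≡ map inj₂ z → ∀ z₀ l x v →
               s ≡ map inj₂ z₀ ++ inj₁ (cell l (null v) x emit) ∷ rights v →
               ∃[ z₁ ] z ≡ z₀ ++ z₁ × Pointwise Terminal (x ∷ v) z₁
  emit-sound ε {z} t≡ z₀ l x v eq = ⊥-elim (not-terminal (map inj₂ z₀) z (trans (sym eq) t≡))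
  emit-sound (s ◅ d) {z} t≡ z₀ l x v eq with invert {v = v} (All.map⁺ (All.universal (λ _ → refl) z₀)) s eq
  ... | emit {a} {y} {v′} t with emit-sound d t≡ (z₀ ∷ʳ a) false y v′
          (sym (trans (cong (_++ _) (map-++ inj₂ z₀ [ a ])) (++-assoc (map inj₂ z₀) _ _)))
  ...   | z₁ , refl , ts = a ∷ z₁ , ++-assoc z₀ [ a ] z₁ , t ∷ ts
  emit-sound (s ◅ d) {z} t≡ z₀ l x v eq | finish {a} t with d
  ... | ε = [ a ] , terminals-injective z (z₀ ∷ʳ a) (trans (sym t≡) (sym (map-++ inj₂ z₀ [ a ]))) , t ∷ []
    where
    terminals-injective : ∀ z z′ → map (inj₂ {A = Cell}) z ≡ map inj₂ z′ → z ≡ z′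
    terminals-injective []      []       _  = refl
    terminals-injective (a ∷ z) (b ∷ z′) eq with ∷-injective eq
    ... | refl , eq′ = cong (a ∷_) (terminals-injective z z′ eq′)
  ... | s′ ◅ _ = ⊥-elim (stuck s′ (sym (map-++ inj₂ z₀ [ a ])))
    where
    stuck : ∀ {s s′ z} → Step s s′ → s ≢ map inj₂ z
    stuck {z = z} (single u v _) = not-terminal u z
    stuck {z = z} (pair u v _)   = not-terminal u z

  -- The state of a leftward sweep: `c` is the part of the old level still to be expanded and `v`
  -- the part of the new level already written.
  Sweep : List (Item m k) → List (Item m k) → List (Fin k) → Set
  Sweep c v z = ∃[ d ] Par P c d × MachineRun (d ++ v) z

  mutual
    -- The recursion follows the machine derivation across all levels. Acceptance of the rest of the
    -- level and the expansion after the turn both come from the same remaining derivation, and are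
    -- therefore extracted together.
    scan-sound : ∀ {s t} → Star Step s t → ∀ {z} → t ≡ map inj₂ z → ∀ u x q v → s ≡ tape u x (scan q) v →
                 Accepts q (lives (x ∷ v)) × Sweep (u ++ x ∷ v) [] z
    scan-sound ε {z} t≡ u x q v eq = ⊥-elim (not-terminal (lefts u) z (trans (sym eq) t≡))
    scan-sound (s ◅ d) t≡ u x q v eq with invert {v = v} (unheaded-lefts u) s eq
    ... | scan {q′ = q′} {y} {v′} r with scan-sound d t≡ (u ∷ʳ x) y q′ v′ (sym (tape-∷ʳ u x y (scan q′) v′))
    ...   | a , sw = accepts-read r a , subst (λ c → Sweep c [] _) (++-assoc u [ x ] (y ∷ v′)) sw
    scan-sound (s ◅ d) t≡ u x q v eq | turn r f =
      accepts-read r ([] f) , back-sound d t≡ u x [] refl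

    back-sound : ∀ {s t} → Star Step s t → ∀ {z} → t ≡ map inj₂ z → ∀ u x v → s ≡ tape u x back v →
                 Sweep (u ∷ʳ x) v z
    back-sound ε {z} t≡ u x v eq = ⊥-elim (not-terminal (lefts u) z (trans (sym eq) t≡))
    back-sound (s ◅ d) t≡ u x v eq with invert {v = v} (unheaded-lefts u) s eq
    ... | restart {y} {γ} {h} l e again
      with refl ← null-true u l
      with scan-sound d t≡ [] y init (γ ++ v) (tape-restart y (scan init) γ v)
    ...   | a , c , ps , run = y ∷ γ , subst (Par P _) (++-identityʳ _) (e ∷ []) ,
      step a ps (subst (λ c → MachineRun c _) (++-identityʳ c) run)
    back-sound (s ◅ d) t≡ u x v eq | restart {y} {γ} {h} l e last
      with refl ← null-true u l
      with z , refl , ts ← emit-sound d t≡ [] true y (γ ++ v) (tape-restart y emit γ v) =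
      y ∷ γ , subst (Par P _) (++-identityʳ _) (e ∷ []) , stop ts
    back-sound (s ◅ d) t≡ u x v eq | back {U′} {x′ = x′} {γ} U≡ e with initLast u
    ... | []      with () ← ++-conicalʳ U′ _ (sym U≡)
    ... | u′ ∷ʳ′ y with refl , eq₁ ← ∷ʳ-injective U′ (lefts u′) (trans (sym U≡) (lefts-∷ʳ u′ y))
      with refl , _ , refl , _ ← cell-injective eq₁
      with back-sound d t≡ u′ y (x′ ∷ γ ++ v) (tape-back u′ y (x′ ∷ γ) v)
    ...   | c , ps , run = c ++ (x′ ∷ γ) ,
      par-++ ps (subst (Par P _) (++-identityʳ _) (e ∷ [])) ,
      subst (λ c → MachineRun c _) (sym (++-assoc c (x′ ∷ γ) v)) run

  generates⇒run : ∀ {z} → Generates z → MachineRun [ live (inj₁ S) ] z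
  generates⇒run d with scan-sound d refl [] (live (inj₁ S)) init [] refl
  ... | a , c , ps , run = step a ps (subst (λ c → MachineRun c _) (++-identityʳ c) run)

  -- From runs to machine derivations

  expand-nonEmpty : ∀ {x δ} → Expand P x δ → ∃[ y ] ∃[ γ ] δ ≡ y ∷ γ
  expand-nonEmpty done                     = _ , _ , refl
  expand-nonEmpty term                     = _ , _ , refl
  expand-nonEmpty (prod {γ = []} p)        = contradiction p nonEmpty
  expand-nonEmpty (prod {γ = X ∷ γ} p)     = _ , _ , refl

  single-step : ∀ {A X γ} u v → Single (A , X , γ) → Step (u ++ inj₁ A ∷ v) (u ++ X ∷ γ ++ v)
  single-step u v s = single u v (singles⁺ s)

  pair-step : ∀ {A B C X γ} u v → Pair (A , B , C , X , γ) →
              Step (u ++ inj₁ A ∷ inj₁ B ∷ v) (u ++ C ∷ X ∷ γ ++ v)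
  pair-step u v s = pair u v (pairs⁺ s)

  emit-complete : ∀ {x v z} → Pointwise Terminal (x ∷ v) z → ∀ l z₀ →
                  Star Step (map inj₂ z₀ ++ inj₁ (cell l (null v) x emit) ∷ rights v) (map inj₂ (z₀ ++ z))
  emit-complete {v = []} (_∷_ {y = a} t []) l z₀ =
    subst (Step _) (sym (map-++ inj₂ z₀ [ a ])) (single-step (map inj₂ z₀) [] (finish l t)) ◅ ε
  emit-complete {v = y ∷ v} (_∷_ {y = a} {ys = z} t ts) l z₀ =
    pair-step (map inj₂ z₀) (rights v) (emit l (null v) y t) ◅
    subst₂ (Star Step)
      (trans (cong (_++ _) (map-++ inj₂ z₀ [ a ])) (++-assoc (map inj₂ z₀) _ _))
      (cong (map inj₂) (++-assoc z₀ [ a ] z))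
      (emit-complete ts false (z₀ ∷ʳ a))

  scan-complete : ∀ v u x q → Accepts q (lives (x ∷ v)) →
    ∃[ u′ ] ∃[ x′ ] u ++ x ∷ v ≡ u′ ∷ʳ x′ × Star Step (tape u x (scan q) v) (tape u′ x′ back [])
  scan-complete [] u x q a with accepts-read⁻ x [] a
  ... | q′ , r , [] f = u , x , refl , single-step (lefts u) [] (turn (null u) r f) ◅ ε
  scan-complete (y ∷ v) u x q a with accepts-read⁻ x (y ∷ v) a
  ... | q′ , r , a′ with scan-complete v (u ∷ʳ x) y q′ a′
  ...   | u′ , x′ , eq , d = u′ , x′ , trans (sym (++-assoc u [ x ] (y ∷ v))) eq ,
    pair-step (lefts u) (rights v) (scan (null u) (null v) y r) ◅
    subst (λ s → Star Step s _) (tape-∷ʳ u x y (scan q′) v) d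

  -- The induction removes items from the right end of `u`, the direction in which the head travels;
  -- every expansion is moved over to `v`.
  back-complete : ∀ {u} → Reverse u → ∀ {x v c γ y d h} → Par P u c → Expand P x γ →
                  c ++ γ ++ v ≡ y ∷ d → Restart h → Star Step (tape u x back v) (tape [] y h d)
  back-complete [] {v = v} [] e eq h with expand-nonEmpty e
  back-complete [] {v = v} [] e refl h | y , γ , refl =
    subst (Step _) (tape-restart y _ γ v) (single-step [] (rights v) (restart (null v) e h)) ◅ ε
  back-complete (u ∶ rs ∶ʳ w) {x} {v} ps e eq h with par-++⁻ u ps | expand-nonEmpty e
  ... | c , _ , refl , ps₁ , (_∷_ {γ = δ} e′ []) | x′ , γ , refl =
    subst₂ Step (sym (tape-∷ʳ u w x back v)) (tape-back u w (x′ ∷ γ) v)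
      (pair-step (lefts u) (rights v) (back (null u) (null v) w e)) ◅
    back-complete rs {v = x′ ∷ γ ++ v} ps₁ e′
      (trans (sym (trans (cong (λ δ → (c ++ δ) ++ x′ ∷ γ ++ v) (++-identityʳ δ)) (++-assoc c δ _))) eq) h

  sweep : ∀ {x v d y d′ h} → Accepts init (lives (x ∷ v)) → Par P (x ∷ v) d → d ≡ y ∷ d′ → Restart h →
          Star Step (tape [] x (scan init) v) (tape [] y h d′)
  sweep {x} {v} {δ} a ps eq h with scan-complete v [] x init a
  ... | u , w , xv≡ , d with par-++⁻ u (subst (λ c → Par P c δ) xv≡ ps)
  ...   | c , _ , refl , ps₁ , e ∷ [] = d ◅◅ back-complete (reverseView u) ps₁ e eq h

  par-nonEmpty : ∀ {x v d} → Par P (x ∷ v) d → ∃[ y ] ∃[ d′ ] d ≡ y ∷ d′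
  par-nonEmpty (e ∷ ps) with expand-nonEmpty e
  ... | y , γ , refl = y , _ , refl

  mutual
    -- The run supplies the guess made at the left end: `last` if it stops on this level, `again` if
    -- it goes on.
    run-complete : ∀ {c z} → MachineRun c z → ∀ {x v} → c ≡ x ∷ v →
                   ∃[ h ] Restart h × Derives (tape [] x h v) z
    run-complete (stop ts)       refl = emit , last , emit-complete ts true []
    run-complete (step a ps run) refl = scan init , again , level-complete a ps run

    level-complete : ∀ {x v d z} → Accepts init (lives (x ∷ v)) → Par P (x ∷ v) d → MachineRun d z →
                     Derives (tape [] x (scan init) v) z
    level-complete a ps run with par-nonEmpty ps
    ... | y , d′ , refl with run-complete run refl
    ...   | h , r , d = sweep a ps refl r ◅◅ d

  run⇒generates : ∀ {z} → MachineRun [ live (inj₁ S) ] z → Generates z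
  run⇒generates (stop (() ∷ _))
  run⇒generates (step a ps run) = level-complete a ps run

-- Tree-controlled languages are context-sensitive

par-mono : ∀ {m k} {P Q : Prods m k} → (∀ {r} → r ∈ P → r ∈ Q) → ∀ {c d} → Par P c d → Par Q c d
par-mono P⊆Q []            = []
par-mono P⊆Q (done ∷ ps)   = done ∷ par-mono P⊆Q ps
par-mono P⊆Q (term ∷ ps)   = term ∷ par-mono P⊆Q ps
par-mono P⊆Q (prod p ∷ ps) = prod (P⊆Q p) ∷ par-mono P⊆Q ps

run-mono : ∀ {m k} {P Q : Prods m k} {R R′ : List (Sym m k) → Set} →
           (∀ {r} → r ∈ P → r ∈ Q) → (∀ {w} → R w → R′ w) → ∀ {c z} → Run P R c z → Run Q R′ c z
run-mono P⊆Q R⊆R′ (stop ts)       = stop ts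
run-mono P⊆Q R⊆R′ (step r ps run) = step (R⊆R′ r) (par-mono P⊆Q ps) (run-mono P⊆Q R⊆R′ run)

run-[] : ∀ {m k} {P : Prods m k} {R z} → Run P R [] z → z ≡ []
run-[] (stop [])         = refl
run-[] (step _ [] run) = run-[] run

module FromTreeControlled {k : ℕ} (G : TCG k) where
  open TCG G renaming (nts to m; start to S)

  _≟_ : DecidableEquality (Sym m k)
  _≟_ = Sum.≡-dec Fin._≟_ Fin._≟_

  open ToNFA _≟_ control
  open NFA nfa using (Accepts; init; accepts?)

  -- The machine needs nonempty right-hand sides. Dropping the erasing rules loses only the empty
  -- word, because such a rule can be used only at the root.
  productive : Prods m k
  productive = filter (λ r → ¬? (empty? (proj₂ r))) rules

  productive-⊆ : ∀ {r} → r ∈ productive → r ∈ rules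
  productive-⊆ p = proj₁ (∈-filter⁻ (λ r → ¬? (empty? (proj₂ r))) p)

  productive-nonEmpty : ∀ {A} → (A , []) ∉ productive
  productive-nonEmpty p = proj₂ (∈-filter⁻ (λ r → ¬? (empty? (proj₂ r))) {xs = rules} p) refl

  open Machine productive productive-nonEmpty S nfa public

  -- An erasing rule at the root gives a tree whose only controlled level is the word `S`, hence the
  -- second condition.
  GeneratesEmpty : Set
  GeneratesEmpty = (S , []) ∈ rules × Accepts init [ inj₁ S ]

  generatesEmpty? : Dec GeneratesEmpty
  generatesEmpty? = ((S , []) ∈? rules) ×-dec accepts? init [ inj₁ S ]
    where open DecMembership (Product.≡-dec (Fin._≟_ {m}) (List.≡-dec _≟_)) using (_∈?_)

  -- This holds for the right-hand side of every rule and is inherited from level to level. Once the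
  -- root has been expanded without erasing, all later expansions are productive.
  ErasureFree : List (Item m k) → Set
  ErasureFree c = (S , []) ∈ rules → live (inj₁ S) ∉ c

  erasing-start : ∀ {A} → (A , []) ∈ rules → A ≡ S
  erasing-start p = proj₁ (All.lookup nonErasing p refl)

  body-erasureFree : ∀ {A γ} → (A , γ) ∈ rules → ErasureFree (map live γ)
  body-erasureFree p e q with _ , X∈ , refl ← ∈-map⁻ live q =
    All.lookup (proj₂ (All.lookup nonErasing e refl)) p X∈

  erasureFree-++ : ∀ c {d} → ErasureFree c → ErasureFree d → ErasureFree (c ++ d)
  erasureFree-++ c f g e p with ∈-++⁻ c p
  ... | inj₁ q = f e q
  ... | inj₂ q = g e q

  restrict-par : ∀ {c d} → ErasureFree c → Par rules c d → Par productive c d × ErasureFree d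
  restrict-par f [] = [] , λ _ ()
  restrict-par f (e ∷ ps) with restrict-par (λ r p → f r (there p)) ps
  restrict-par f (done {a} ∷ ps) | ps′ , g = done ∷ ps′ , erasureFree-++ [ done a ] (λ { _ (here ()) }) g
  restrict-par f (term {a} ∷ ps) | ps′ , g = term ∷ ps′ , erasureFree-++ [ done a ] (λ { _ (here ()) }) g
  restrict-par f (prod {A} {[]} p ∷ ps) | ps′ , g with refl ← erasing-start p =
    contradiction (here refl) (f p)
  restrict-par f (prod {A} {X ∷ γ} p ∷ ps) | ps′ , g =
    prod (∈-filter⁺ (λ r → ¬? (empty? (proj₂ r))) p (λ ())) ∷ ps′ ,
    erasureFree-++ (map live (X ∷ γ)) (body-erasureFree p) g

  restrict-run : ∀ {R c z} → ErasureFree c → Run rules R c z → Run productive R c z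
  restrict-run f (stop ts)       = stop ts
  restrict-run f (step r ps run) with restrict-par f ps
  ... | ps′ , g = step r ps′ (restrict-run g run)

  Target : Lang k
  Target = ToContextSensitive.Target grammar generatesEmpty?

  run⇒target : ∀ {z} → Run rules (Accepts init) [ live (inj₁ S) ] z → Target z
  run⇒target (stop (() ∷ _))
  run⇒target (step r (prod {γ = []} p ∷ []) run)    = inj₁ (run-[] run , p , r)
  run⇒target (step r (prod {γ = X ∷ γ} p ∷ []) run) = inj₂ (run⇒generates (step r
    (prod (∈-filter⁺ (λ r → ¬? (empty? (proj₂ r))) p (λ ())) ∷ [])
    (restrict-run (erasureFree-++ (map live (X ∷ γ)) (body-erasureFree p) (λ _ ())) run)))

  target⇒run : ∀ {z} → Target z → Run rules (Accepts init) [ live (inj₁ S) ] z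
  target⇒run (inj₁ (refl , p , r)) = step r (prod p ∷ []) (stop [])
  target⇒run (inj₂ g)              = run-mono productive-⊆ (λ a → a) (generates⇒run g)

  L-TCG⇔target : ∀ z → L-TCG G z ⇔ Target z
  L-TCG⇔target z = mk⇔
    (λ d → run⇒target (run-mono (λ p → p) L-RLG⇒accepts (L-TCG⇒run G d)))
    (λ t → run⇒L-TCG G (run-mono (λ p → p) accepts⇒L-RLG (target⇒run t)))

theorem23 : (n : ℕ) → 1 ≤ n → (k : ℕ) (L : Lang k) → InTC-RL n L ⇔ InCS L
theorem23 n 1≤n k L = mk⇔ tc⇒cs cs⇒tc
  where
  tc⇒cs : InTC-RL n L → InCS L
  tc⇒cs (G , _ , L⇔) = H , λ z → ⇔-trans (L⇔ z) (⇔-trans (L-TCG⇔target z) (T⇔ z))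
    where
    open FromTreeControlled G
    H  = proj₁ (ToContextSensitive.context-sensitive grammar generatesEmpty?)
    T⇔ = proj₂ (ToContextSensitive.context-sensitive grammar generatesEmpty?)
  cs⇒tc : InCS L → InTC-RL n L
  -- The control grammar has one nonterminal, so the bound on its number is literally `1≤n`.
  cs⇒tc (G , L⇔) = grammar , 1≤n , λ z → ⇔-trans (L⇔ z) (mk⇔ L-CSG⇒L-TCG L-TCG⇒L-CSG)
    where open ToTreeControlled G
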